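{- For every $n\ge 1$, the set $\{x_\lambda : \lambda\vdash n\}$ is a basis for $\mathrm{Sym}^n$. Moreover, if $\lambda$ and $\gamma$ are integer partitions, then $$x_\lambda x_\gamma=x_{\lambda|\gamma}.$$
   Context: An integer partition $\lambda=\lambda_1\lambda_2\cdots\lambda_l\vdash n$ is a nonincreasing list of positive integers with sum $n$. For integer partitions $\lambda\vdash n$ and $\gamma\vdash m$, $\lambda|\gamma\vdash n+m$ is the integer partition whose parts are the parts of $\lambda$ together with those of $\gamma$ (with multiplicity). $\mathrm{Sym}=\bigoplus_{n\ge0}\mathrm{Sym}^n\subset\mathbb{Q}[[x_1,x_2,\dots]]$ is the algebra of symmetric functions over $\mathbb{Q}$ in commuting variables, and $\mathrm{Sym}^n$ its degree-$n$ homogeneous piece. A set partition $\pi\vdash[n]$ of $[n]=\{1,\dots,n\}$ is a collection of disjoint nonempty subsets (blocks) with union $[n]$. Set partitions of $[n]$ are ordered by refinement: $\sigma\le\pi$ if each block of $\sigma$ is contained in a block of $\pi$. $u$ is the Möbius function of this lattice: for $\sigma\le\pi$, $u(\sigma,\pi)=\prod_i(-1)^{k_i-1}(k_i-1)!$ where $k_i$ is the number of blocks of $\sigma$ contained in the $i$th block of $\pi$. For set partitions $\pi\vdash[n]$ and $\sigma\vdash[m]$, the slash product $\pi|\sigma\vdash[n+m]$ has as blocks those of $\pi$ together with the blocks of $\sigma$ shifted by $n$. $\llbracket n\rrbracket$ is the set partition of $[n]$ with one block, and for $\lambda=\lambda_1\cdots\lambda_l$, $\llbracket\lambda\rrbracket=\llbracket\lambda_1\rrbracket|\llbracket\lambda_2\rrbracket|\cdots|\llbracket\lambda_l\rrbracket$.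 In noncommuting variables $\mathbf{x}_1,\mathbf{x}_2,\dots$, for $\pi\vdash[n]$ let $p_\pi=\sum\mathbf{x}_{i_1}\cdots\mathbf{x}_{i_n}$ over all tuples of positive integers with $i_j=i_k$ whenever $j,k$ are in the same block of $\pi$, and let $x_\pi=\sum_{\sigma\leq\pi}u(\sigma,\pi)\,p_\sigma$. Let $\rho:\mathbb{Q}[[\mathbf{x}_1,\mathbf{x}_2,\dots]]\to\mathbb{Q}[[x_1,x_2,\dots]]$ be the algebra morphism letting the variables commute ($\mathbf{x}_i\mapsto x_i$). For an integer partition $\lambda$, the extra symmetric function in $\mathrm{Sym}$ is $$x_\lambda=\rho(x_{\llbracket\lambda\rrbracket}).$$ -}

module Defs where

open import Data.Bool using (true; false; if_then_else_)
open import Data.Fin using (Fin; _↑ˡ_; _↑ʳ_; splitAt)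
import Data.Fin.Properties as Fin
open import Data.Fin.Subset using (Subset; inside; outside; ⊤; ⊥; _∈_; _⊆_; _∩_; Nonempty; Empty)
open import Data.Fin.Subset.Properties using (_∈?_; _⊆?_; nonempty?; ∈⊤; ∉⊥; x∈p∩q⁺; x∈p∩q⁻)
open import Data.Integer using (ℤ; +_; 1ℤ; -1ℤ)
import Data.Integer as ℤ
open import Data.List
  using (List; []; _∷_; _++_; _∷ʳ_; [_]; map; foldr; filter; length; lookup; upTo; merge; mapMaybe; cartesianProductWith)
open import Data.List.Membership.Propositional using () renaming (_∈_ to _∈ᴸ_)
import Data.List.Properties as List
open import Data.List.Relation.Binary.Permutation.Propositional using (_↭_; ↭-sym)
open import Data.List.Relation.Binary.Permutation.Propositional.Properties using (merge-↭; All-resp-↭)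
open import Data.List.Relation.Unary.All as All using (All; []; _∷_)
import Data.List.Relation.Unary.All.Properties as All
open import Data.List.Relation.Unary.AllPairs as AllPairs using (AllPairs; []; _∷_)
import Data.List.Relation.Unary.AllPairs.Properties as AllPairs
open import Data.List.Relation.Unary.Any as Any using (Any; here; there)
import Data.List.Relation.Unary.Any.Properties as Any
open import Data.List.Relation.Unary.Linked using (Linked)
open import Data.List.Relation.Unary.Sorted.TotalOrder.Properties using (merge⁺)
open import Data.List.Relation.Unary.Unique.Propositional using (Unique)
import Data.Maybe as Maybe
open import Data.Nat using (ℕ; zero; suc; _+_; _∸_; _<_; _≥_; _!)
open import Data.Nat.ListAction using (sum)
open import Data.Nat.ListAction.Properties using (sum-++; sum-↭)
open import Data.Nat.Properties using (_≟_; _≥?_; ≤-decTotalOrder; +-comm; +-identityʳ; <⇒≢)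
open import Data.Product using (_×_; _,_; ∃; ∃-syntax)
open import Data.Rational using (ℚ; 0ℚ; 1ℚ) renaming (_+_ to _+ℚ_; _*_ to _*ℚ_; _/_ to _/ℚ_)
open import Data.Sum using (_⊎_; inj₁; inj₂)
open import Data.Vec using (here; there) renaming ([] to []ᵛ; _∷_ to _∷ᵛ_; _++_ to _++ᵛ_)
open import Function using (_∘_)
open import Relation.Binary.Construct.Flip.EqAndOrd using () renaming (decTotalOrder to flipOrder)
open import Relation.Binary.PropositionalEquality hiding ([_])
open import Relation.Nullary using (Dec; yes; no; does; contradiction)
open import Relation.Nullary.Decidable using (_×-dec_; _→-dec_; ¬?; map′; dec⇒maybe)
open import Level using (0ℓ)
open import Relation.Unary using (Pred; Decidable)

sumℚ : List ℚ → ℚ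
sumℚ = foldr _+ℚ_ 0ℚ

record IntegerPartition (n : ℕ) : Set where
  constructor mkPartition
  field
    parts         : List ℕ
    nonincreasing : Linked _≥_ parts
    positive      : All (0 <_) parts
    size          : sum parts ≡ n

open IntegerPartition public

infixr 5 _∣ᵖ_

_∣ᵖ_ : ∀ {n m} → IntegerPartition n → IntegerPartition m → IntegerPartition (n + m)
μ ∣ᵖ γ = record
  { parts         = merge _≥?_ (parts μ) (parts γ)
  ; nonincreasing = merge⁺ (flipOrder ≤-decTotalOrder) (nonincreasing μ) (nonincreasing γ)
  ; positive      = All-resp-↭ (↭-sym merged) (All.++⁺ (positive μ) (positive γ))
  ; size          = trans (sum-↭ merged)
                      (trans (sum-++ (parts μ) (parts γ)) (cong₂ _+_ (size μ) (size γ)))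
  }
  where
  merged : merge _≥?_ (parts μ) (parts γ) ↭ parts μ ++ parts γ
  merged = merge-↭ _≥?_ (parts μ) (parts γ)

record IsSetPartition {n} (bs : List (Subset n)) : Set where
  field
    nonempty : All Nonempty bs
    disjoint : AllPairs (λ B C → Empty (B ∩ C)) bs
    covering : ∀ i → Any (i ∈_) bs

isSetPartition? : ∀ {n} → Decidable (IsSetPartition {n})
isSetPartition? bs = map′
  (λ (ne , di , co) → record { nonempty = ne ; disjoint = di ; covering = co })
  (λ π → let open IsSetPartition π in nonempty , disjoint , covering)
  (All.all? nonempty? bs
    ×-dec AllPairs.allPairs? (λ B C → ¬? (nonempty? (B ∩ C))) bs
    ×-dec Fin.all? (λ i → Any.any? (i ∈?_) bs))

-- The order in which the blocks are listed carries no meaning; every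
-- construction below is insensitive to it.
record SetPartition (n : ℕ) : Set where
  constructor mkSetPartition
  field
    blocks         : List (Subset n)
    isSetPartition : IsSetPartition blocks

open SetPartition public

subsets : ∀ n → List (Subset n)
subsets zero    = [ []ᵛ ]
subsets (suc n) = map (inside ∷ᵛ_) (subsets n) ++ map (outside ∷ᵛ_) (subsets n)

sublists : ∀ {A : Set} → List A → List (List A)
sublists []       = [ [] ]
sublists (a ∷ as) = map (a ∷_) (sublists as) ++ sublists as

-- subsets n has no repetitions, so its sublists represent each collection
-- of subsets of [n] exactly once.  Hence every set partition of [n] is
-- listed exactly once, with its blocks in the order of subsets n.
setPartitions : ∀ n → List (SetPartition n)
setPartitions n =
  mapMaybe (λ bs → Maybe.map (mkSetPartition bs) (dec⇒maybe (isSetPartition? bs)))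
           (sublists (subsets n))

infix 4 _≼_ _≼?_

_≼_ : ∀ {n} → SetPartition n → SetPartition n → Set
σ ≼ π = All (λ B → Any (B ⊆_) (blocks π)) (blocks σ)

_≼?_ : ∀ {n} (σ π : SetPartition n) → Dec (σ ≼ π)
σ ≼? π = All.all? (λ B → Any.any? (B ⊆?_) (blocks π)) (blocks σ)

-- Used only for σ ≼ π, where every k below is at least 1.
u : ∀ {n} → SetPartition n → SetPartition n → ℤ
u σ π = foldr ℤ._*_ 1ℤ (map factor (blocks π))
  where
  factor : Subset _ → ℤ
  factor B = let k = length (filter (_⊆? B) (blocks σ)) in
    (-1ℤ ℤ.^ (k ∸ 1)) ℤ.* + ((k ∸ 1) !)

∈-++⁺ˡ : ∀ {n m} {p : Subset n} (q : Subset m) {i} → i ∈ p → (i ↑ˡ m) ∈ (p ++ᵛ q)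
∈-++⁺ˡ q here      = here
∈-++⁺ˡ q (there h) = there (∈-++⁺ˡ q h)

∈-++⁺ʳ : ∀ {n m} (p : Subset n) {q : Subset m} {i} → i ∈ q → (n ↑ʳ i) ∈ (p ++ᵛ q)
∈-++⁺ʳ []ᵛ      h = h
∈-++⁺ʳ (_ ∷ᵛ p) h = there (∈-++⁺ʳ p h)

∈-++⁻ : ∀ {n m} (p : Subset n) (q : Subset m) {i} → i ∈ (p ++ᵛ q) →
        (∃[ j ] j ↑ˡ m ≡ i × j ∈ p) ⊎ (∃[ j ] n ↑ʳ j ≡ i × j ∈ q)
∈-++⁻ []ᵛ      q h    = inj₂ (_ , refl , h)
∈-++⁻ (_ ∷ᵛ p) q here = inj₁ (_ , refl , here)
∈-++⁻ (_ ∷ᵛ p) q (there h) with ∈-++⁻ p q h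
... | inj₁ (j , refl , j∈p) = inj₁ (_ , refl , there j∈p)
... | inj₂ (j , refl , j∈q) = inj₂ (_ , refl , j∈q)

-- Subsets of [n] and [m] as subsets of [n+m], the latter shifted by n.
embedˡ : ∀ {n} m → Subset n → Subset (n + m)
embedˡ m B = B ++ᵛ ⊥ {m}

embedʳ : ∀ n {m} → Subset m → Subset (n + m)
embedʳ n B = ⊥ {n} ++ᵛ B

∈-embedˡ⁻ : ∀ {n m} {B : Subset n} {i} → i ∈ embedˡ m B → ∃[ j ] j ↑ˡ m ≡ i × j ∈ B
∈-embedˡ⁻ {m = m} {B} h with ∈-++⁻ B (⊥ {m}) h
... | inj₁ r           = r
... | inj₂ (_ , _ , f) = contradiction f ∉⊥

∈-embedʳ⁻ : ∀ {n m} {B : Subset m} {i} → i ∈ embedʳ n B → ∃[ j ] n ↑ʳ j ≡ i × j ∈ B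
∈-embedʳ⁻ {n} {B = B} h with ∈-++⁻ (⊥ {n}) B h
... | inj₁ (_ , _ , f) = contradiction f ∉⊥
... | inj₂ r           = r

infixr 5 _∣ˢ_

_∣ˢ_ : ∀ {n m} → SetPartition n → SetPartition m → SetPartition (n + m)
_∣ˢ_ {n} {m} π σ = record
  { blocks         = map (embedˡ m) (blocks π) ++ map (embedʳ n) (blocks σ)
  ; isSetPartition = record
    { nonempty = All.++⁺
        (All.map⁺ (All.map (λ (i , h) → (i ↑ˡ m) , ∈-++⁺ˡ ⊥ h) π.nonempty))
        (All.map⁺ (All.map (λ (i , h) → (n ↑ʳ i) , ∈-++⁺ʳ (⊥ {n}) h) σ.nonempty))
    ; disjoint = AllPairs.++⁺
        (AllPairs.map⁺ (AllPairs.map disjointˡ π.disjoint))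
        (AllPairs.map⁺ (AllPairs.map disjointʳ σ.disjoint))
        (All.map⁺ (All.universal (λ B → All.map⁺ (All.universal (apart B) (blocks σ))) (blocks π)))
    ; covering = cover
    }
  }
  where
  module π = IsSetPartition (isSetPartition π)
  module σ = IsSetPartition (isSetPartition σ)

  disjointˡ : ∀ {B C : Subset n} → Empty (B ∩ C) → Empty (embedˡ m B ∩ embedˡ m C)
  disjointˡ {B} {C} e (i , h) with x∈p∩q⁻ (embedˡ m B) (embedˡ m C) h
  ... | hB , hC with ∈-embedˡ⁻ {m = m} hB | ∈-embedˡ⁻ {m = m} hC
  ...   | j , refl , j∈B | k , eq , k∈C =
    e (j , x∈p∩q⁺ (j∈B , subst (_∈ C) (Fin.↑ˡ-injective m k j eq) k∈C))

  disjointʳ : ∀ {B C : Subset m} → Empty (B ∩ C) → Empty (embedʳ n B ∩ embedʳ n C)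
  disjointʳ {B} {C} e (i , h) with x∈p∩q⁻ (embedʳ n B) (embedʳ n C) h
  ... | hB , hC with ∈-embedʳ⁻ {n} hB | ∈-embedʳ⁻ {n} hC
  ...   | j , refl , j∈B | k , eq , k∈C =
    e (j , x∈p∩q⁺ (j∈B , subst (_∈ C) (Fin.↑ʳ-injective n k j eq) k∈C))

  apart : ∀ (B : Subset n) (C : Subset m) → Empty (embedˡ m B ∩ embedʳ n C)
  apart B C (i , h) with x∈p∩q⁻ (embedˡ m B) (embedʳ n C) h
  ... | hB , hC with ∈-embedˡ⁻ {m = m} hB | ∈-embedʳ⁻ {n} hC
  ...   | j , refl , _ | k , eq , _
      with trans (sym (Fin.splitAt-↑ˡ n j m)) (trans (cong (splitAt n) (sym eq)) (Fin.splitAt-↑ʳ n m k))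
  ...     | ()

  cover : ∀ i → Any (i ∈_) (map (embedˡ m) (blocks π) ++ map (embedʳ n) (blocks σ))
  cover i with splitAt n i in eq
  ... | inj₁ j rewrite sym (Fin.splitAt⁻¹-↑ˡ {i = i} eq) =
    Any.++⁺ˡ (Any.map⁺ (Any.map (∈-++⁺ˡ ⊥) (π.covering j)))
  ... | inj₂ k rewrite sym (Fin.splitAt⁻¹-↑ʳ {i = i} eq) =
    Any.++⁺ʳ (map (embedˡ m) (blocks π)) (Any.map⁺ (Any.map (∈-++⁺ʳ (⊥ {n})) (σ.covering k)))

-- Blocks are nonempty, so [0] has only the partition with no blocks.
⟦_⟧₁ : ∀ n → SetPartition n
⟦ zero ⟧₁  = mkSetPartition [] (record { nonempty = [] ; disjoint = [] ; covering = λ () })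
⟦ suc n ⟧₁ = mkSetPartition [ ⊤ ] (record
  { nonempty = (Fin.zero , here) ∷ []
  ; disjoint = [] ∷ []
  ; covering = λ _ → here ∈⊤
  })

⟦_⟧ : (ns : List ℕ) → SetPartition (sum ns)
⟦ [] ⟧     = ⟦ 0 ⟧₁
⟦ n ∷ ns ⟧ = ⟦ n ⟧₁ ∣ˢ ⟦ ns ⟧

-- Power series in noncommuting variables, indexed by ℕ: the coefficient
-- of 𝐱_{i₁}⋯𝐱_{iₙ} is the value at the word i₁ ∷ ⋯ ∷ iₙ ∷ [].

NCSeries : Set
NCSeries = List ℕ → ℚ

SameBlock : ∀ {n} → SetPartition n → Fin n → Fin n → Set
SameBlock π i j = Any (λ B → i ∈ B × j ∈ B) (blocks π)

ConstantOnBlocks : (w : List ℕ) → SetPartition (length w) → Set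
ConstantOnBlocks w π = ∀ i j → SameBlock π i j → lookup w i ≡ lookup w j

constantOnBlocks? : ∀ w π → Dec (ConstantOnBlocks w π)
constantOnBlocks? w π = Fin.all? λ i → Fin.all? λ j →
  Any.any? (λ B → i ∈? B ×-dec j ∈? B) (blocks π) →-dec lookup w i ≟ lookup w j

p : ∀ {n} → SetPartition n → NCSeries
p {n} π w with length w ≟ n
... | yes refl = if does (constantOnBlocks? w π) then 1ℚ else 0ℚ
... | no  _    = 0ℚ

x : ∀ {n} → SetPartition n → NCSeries
x {n} π w = sumℚ (map (λ σ → (u σ π /ℚ 1) *ℚ p σ w) (filter (_≼? π) (setPartitions n)))

-- Power series in commuting variables.  The monomial x₀^{e₀}⋯x_{k-1}^{e_{k-1}}
-- is given by its exponents e₀ ∷ ⋯ ∷ e_{k-1} ∷ []; since trailing zeros do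
-- not change the monomial, coefficients must not depend on them.

record Series : Set where
  constructor mkSeries
  field
    coeff    : List ℕ → ℚ
    coeff-∷ʳ : ∀ e → coeff (e ∷ʳ 0) ≡ coeff e

open Series public

infix 4 _≈ˢ_

_≈ˢ_ : Series → Series → Set
f ≈ˢ g = ∀ e → coeff f e ≡ coeff g e

0ˢ : Series
0ˢ = mkSeries (λ _ → 0ℚ) (λ _ → refl)

infixl 6 _+ˢ_
infixl 7 _*ˢ_ _·ˢ_

_+ˢ_ : Series → Series → Series
f +ˢ g = mkSeries (λ e → coeff f e +ℚ coeff g e)
                  (λ e → cong₂ _+ℚ_ (coeff-∷ʳ f e) (coeff-∷ʳ g e))

_·ˢ_ : ℚ → Series → Series
c ·ˢ f = mkSeries (λ e → c *ℚ coeff f e) (λ e → cong (c *ℚ_) (coeff-∷ʳ f e))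

-- All (d , d′) with d + d′ = e, i.e. all factorisations of a monomial.
factorisations : List ℕ → List (List ℕ × List ℕ)
factorisations []      = [ [] , [] ]
factorisations (a ∷ e) =
  cartesianProductWith (λ i (d , d′) → i ∷ d , (a ∸ i) ∷ d′) (upTo (suc a)) (factorisations e)

map-cartesianProductWith :
  ∀ {A B C D B′ : Set} (g : C → D) (h : B → B′) {f : A → B → C} {f′ : A → B′ → D} →
  (∀ a b → g (f a b) ≡ f′ a (h b)) → ∀ as bs →
  map g (cartesianProductWith f as bs) ≡ cartesianProductWith f′ as (map h bs)
map-cartesianProductWith g h eq []       bs = refl
map-cartesianProductWith g h {f} eq (a ∷ as) bs = trans
  (List.map-++ g (map (f a) bs) _)
  (cong₂ _++_
    (trans (sym (List.map-∘ bs)) (trans (List.map-cong (eq a) bs) (List.map-∘ bs)))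
    (map-cartesianProductWith g h eq as bs))

pad : List ℕ × List ℕ → List ℕ × List ℕ
pad (d , d′) = d ∷ʳ 0 , d′ ∷ʳ 0

factorisations-∷ʳ : ∀ e → factorisations (e ∷ʳ 0) ≡ map pad (factorisations e)
factorisations-∷ʳ []      = refl
factorisations-∷ʳ (a ∷ e) = trans
  (cong (cartesianProductWith _ (upTo (suc a))) (factorisations-∷ʳ e))
  (sym (map-cartesianProductWith pad pad (λ _ _ → refl) (upTo (suc a)) (factorisations e)))

_*ˢ_ : Series → Series → Series
f *ˢ g = mkSeries
  (λ e → sumℚ (map term (factorisations e)))
  (λ e → cong sumℚ (trans
    (cong (map term) (factorisations-∷ʳ e))
    (trans (sym (List.map-∘ (factorisations e)))
           (List.map-cong (λ (d , d′) → cong₂ _*ℚ_ (coeff-∷ʳ f d) (coeff-∷ʳ g d′)) (factorisations e)))))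
  where
  term : List ℕ × List ℕ → ℚ
  term (d , d′) = coeff f d *ℚ coeff g d′

-- Letting the variables commute: the coefficient of a monomial in ρ F is
-- the sum of the coefficients of F at the finitely many words whose letters
-- multiply to that monomial.

-- Words of length n in the letters 0, …, k - 1.
words : ℕ → ℕ → List (List ℕ)
words k zero    = [ [] ]
words k (suc n) = cartesianProductWith _∷_ (upTo k) (words k n)

occurrences : List ℕ → ℕ → ℕ
occurrences w i = length (filter (i ≟_) w)

exponents : ℕ → List ℕ → List ℕ
exponents k w = map (occurrences w) (upTo k)

arrangements : List ℕ → List (List ℕ)
arrangements e =
  filter (λ w → List.≡-dec _≟_ (exponents (length e) w) e) (words (length e) (sum e))

exponents-suc : ∀ k w → exponents (suc k) w ≡ exponents k w ∷ʳ occurrences w k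
exponents-suc k w = trans (cong (map (occurrences w)) (sym (List.upTo-∷ʳ k)))
                          (List.map-++ (occurrences w) (upTo k) [ k ])

filter-map-∷ : ∀ {k a} → a ≢ k → ∀ ws →
  filter (λ w → occurrences w k ≟ 0) (map (a ∷_) ws) ≡
  map (a ∷_) (filter (λ w → occurrences w k ≟ 0) ws)
filter-map-∷ a≢k [] = refl
filter-map-∷ {k} {a} a≢k (w ∷ ws)
  rewrite List.filter-reject (k ≟_) {x = a} {xs = w} (a≢k ∘ sym)
  with does (occurrences w k ≟ 0)
... | true  = cong ((a ∷ w) ∷_) (filter-map-∷ a≢k ws)
... | false = filter-map-∷ a≢k ws

filter-map-∷-self : ∀ k ws → filter (λ w → occurrences w k ≟ 0) (map (k ∷_) ws) ≡ []
filter-map-∷-self k [] = refl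
filter-map-∷-self k (w ∷ ws)
  rewrite List.filter-accept (k ≟_) {x = k} {xs = w} refl = filter-map-∷-self k ws

filter-product : ∀ {k as} → All (_≢ k) as → ∀ ws →
  filter (λ w → occurrences w k ≟ 0) (cartesianProductWith _∷_ as ws) ≡
  cartesianProductWith _∷_ as (filter (λ w → occurrences w k ≟ 0) ws)
filter-product [] ws = refl
filter-product {as = a ∷ as} (a≢k ∷ as≢k) ws = trans
  (List.filter-++ _ (map (a ∷_) ws) _)
  (cong₂ _++_ (filter-map-∷ a≢k ws) (filter-product as≢k ws))

words-suc : ∀ k n → filter (λ w → occurrences w k ≟ 0) (words (suc k) n) ≡ words k n
words-suc k zero    = refl
words-suc k (suc n) = begin
  filter Q? (cartesianProductWith _∷_ (upTo (suc k)) W)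
    ≡⟨ cong (λ as → filter Q? (cartesianProductWith _∷_ as W)) (sym (List.upTo-∷ʳ k)) ⟩
  filter Q? (cartesianProductWith _∷_ (upTo k ∷ʳ k) W)
    ≡⟨ cong (filter Q?) (List.cartesianProductWith-distribʳ-++ _∷_ (upTo k) [ k ] W) ⟩
  filter Q? (cartesianProductWith _∷_ (upTo k) W ++ (map (k ∷_) W ++ []))
    ≡⟨ List.filter-++ Q? (cartesianProductWith _∷_ (upTo k) W) _ ⟩
  filter Q? (cartesianProductWith _∷_ (upTo k) W) ++ filter Q? (map (k ∷_) W ++ [])
    ≡⟨ cong₂ _++_
         (trans (filter-product (All.map <⇒≢ (All.all-upTo k)) W)
                (cong (cartesianProductWith _∷_ (upTo k)) (words-suc k n)))
         (trans (cong (filter Q?) (List.++-identityʳ (map (k ∷_) W))) (filter-map-∷-self k W)) ⟩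
  words k (suc n) ++ []
    ≡⟨ List.++-identityʳ _ ⟩
  words k (suc n) ∎
  where
  open ≡-Reasoning
  Q? = λ w → occurrences w k ≟ 0
  W  = words (suc k) n

filter-filter : ∀ {A : Set} {P Q R : Pred A 0ℓ} (P? : Decidable P) (Q? : Decidable Q)
  (R? : Decidable R) → (∀ {a} → R a → P a) → (∀ {a} → R a → Q a) → (∀ {a} → P a → Q a → R a) →
  ∀ as → filter R? as ≡ filter P? (filter Q? as)
filter-filter P? Q? R? rp rq pqr [] = refl
filter-filter P? Q? R? rp rq pqr (a ∷ as) with ih ← filter-filter P? Q? R? rp rq pqr as | Q? a
... | no ¬q = trans (List.filter-reject R? (¬q ∘ rq)) ih
... | yes q with P? a
...   | no ¬p = trans (List.filter-reject R? (¬p ∘ rp)) ih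
...   | yes p = trans (List.filter-accept R? (pqr p q)) (cong (a ∷_) ih)

arrangements-∷ʳ : ∀ e → arrangements (e ∷ʳ 0) ≡ arrangements e
arrangements-∷ʳ e rewrite List.length-++ e {[ 0 ]} | +-comm (length e) 1
                        | sum-++ e [ 0 ] | +-identityʳ (sum e) = trans
  (filter-filter P? Q? R?
    (λ {w} r → List.∷ʳ-injectiveˡ _ _ (trans (sym (exponents-suc k w)) r))
    (λ {w} r → List.∷ʳ-injectiveʳ (exponents k w) e (trans (sym (exponents-suc k w)) r))
    (λ {w} p q → trans (exponents-suc k w) (cong₂ _∷ʳ_ p q))
    (words (suc k) (sum e)))
  (cong (filter P?) (words-suc k (sum e)))
  where
  k  = length e
  P? = λ w → List.≡-dec _≟_ (exponents k w) e
  Q? = λ w → occurrences w k ≟ 0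
  R? = λ w → List.≡-dec _≟_ (exponents (suc k) w) (e ∷ʳ 0)

ρ : NCSeries → Series
ρ F = mkSeries (λ e → sumℚ (map F (arrangements e)))
               (λ e → cong (sumℚ ∘ map F) (arrangements-∷ʳ e))

xᵖ : ∀ {n} → IntegerPartition n → Series
xᵖ μ = ρ (x ⟦ parts μ ⟧)

-- Permuting the variables permutes the entries of an exponent list, padded
-- with enough zeros.
record Sym (n : ℕ) (f : Series) : Set where
  field
    homogeneous : ∀ e → sum e ≢ n → coeff f e ≡ 0ℚ
    symmetric   : ∀ {e e′} → e ↭ e′ → coeff f e ≡ coeff f e′

linearCombination : ∀ {I : Set} → (I → ℚ) → (I → Series) → List I → Series
linearCombination c v = foldr (λ i f → c i ·ˢ v i +ˢ f) 0ˢ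

record IsBasis {I : Set} (V : Series → Set) (v : I → Series) : Set where
  field
    inSubspace  : ∀ i → V (v i)
    independent : ∀ (c : I → ℚ) is → Unique is → linearCombination c v is ≈ˢ 0ˢ →
                  ∀ {i} → i ∈ᴸ is → c i ≡ 0ℚ
    spanning    : ∀ f → V f → ∃ λ c → ∃ λ is → f ≈ˢ linearCombination c v is

{-# OPTIONS --safe #-}
-- Since ρ (p σ) is the product of the power sums whose degrees are the block
-- sizes of σ, ρ (x ⟦λ⟧) is a combination of power sum products indexed by the
-- set partitions below ⟦λ⟧.  The set partitions below π ∣ˢ σ are the slash
-- products of those below π with those below σ, and the Möbius function is
-- multiplicative along this bijection; as power sum products multiply by
-- concatenating degrees, this gives x_λ x_γ = x_{λ|γ}.  For the basis property,
-- x_λ equals p_λ plus products of more power sums, and p_λ equals a nonzero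
-- multiple of m_λ plus monomial symmetric functions with fewer parts, so both
-- transition matrices x → p → m are triangular and invertible over ℚ.
module Submission where

open import Defs
open import Data.Bool using (true; false; if_then_else_)
open import Data.Fin as Fin using (Fin; _↑ˡ_; _↑ʳ_)
import Data.Fin.Properties as Fin
open import Data.Fin.Subset using (Subset; inside; outside; ⊤; ⊥; _∩_; Nonempty; Empty; ∣_∣; _⊆_)
  renaming (_∈_ to _∈ˢ_; _∉_ to _∉ˢ_)
open import Data.Fin.Subset.Properties
  using (_∈?_; _⊆?_; x∈p∩q⁺; x∈p∩q⁻; drop-there; ∣⊤∣≡n; ∣⊥∣≡0; ⊆-antisym; ⊆⊤; x∈p⇒∣p-x∣<∣p∣)
open import Data.Integer as ℤ using (ℤ; 1ℤ; -1ℤ)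
import Data.Integer.Properties as ℤ
open import Data.List as List
  using (List; []; _∷_; _++_; _∷ʳ_; map; filter; foldr; length; lookup; replicate; zipWith; mapMaybe;
         upTo; applyUpTo; cartesianProductWith; concatMap; deduplicate)
open import Data.List.Membership.Propositional using (_∈_; find)
open import Data.List.Membership.Propositional.Properties
  using (∈-lookup; ∈-upTo⁺; ∈-concatMap⁺; ∈-deduplicate⁺; ∈-cartesianProductWith⁺)
import Data.List.Properties as List
open import Data.List.Relation.Binary.Permutation.Propositional as Perm
  using (_↭_; ↭-sym; ↭-trans; ↭-reflexive; ↭-refl; ↭⇒↭ₛ)
import Data.List.Relation.Binary.Permutation.Propositional.Properties as Perm
open import Data.List.Relation.Binary.Pointwise using (Pointwise-≡⇒≡)
open import Data.List.Relation.Unary.All as All using (All; []; _∷_)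
import Data.List.Relation.Unary.All.Properties as All
open import Data.List.Relation.Unary.AllPairs as AllPairs using (AllPairs; []; _∷_)
import Data.List.Relation.Unary.AllPairs.Properties as AllPairs
open import Data.List.Relation.Unary.Any as Any using (Any; here; there)
import Data.List.Relation.Unary.Any.Properties as Any
import Data.List.Relation.Unary.Linked as Linked
open import Data.List.Relation.Unary.Sorted.TotalOrder.Properties using (↗↭↗⇒≋)
open import Data.List.Relation.Unary.Unique.DecPropositional.Properties using (deduplicate-!)
open import Data.List.Relation.Unary.Unique.Propositional using (Unique)
import Data.List.Relation.Unary.Unique.Propositional.Properties as Unique
import Data.Maybe as Maybe
open import Data.Nat as ℕ using (ℕ; zero; suc; _∸_; _<_; _≤_; _≥_; _!)
open import Data.Nat.ListAction using (sum)
open import Data.Nat.ListAction.Properties using (sum-++; sum-↭)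
import Data.Nat.Properties as ℕ
open import Data.Product using (_×_; _,_; proj₂; ∃; ∃₂; ∃-syntax)
open import Data.Rational as ℚ using (ℚ; 0ℚ; 1ℚ; _+_; _*_; _-_; _/_; 1/_)
import Data.Rational.Properties as ℚ
open import Data.Rational.Solver using (module +-*-Solver)
import Data.Rational.Unnormalised as ℚᵘ
import Data.Rational.Unnormalised.Properties as ℚᵘ
open import Data.Sum using (_⊎_; inj₁; inj₂)
open import Data.Vec as Vec using ([]; _∷_; here; there)
open import Function using (_∘_; mk⇔)
open import Level using (0ℓ)
open import Relation.Binary using (DecTotalOrder; DecidableEquality)
open import Relation.Binary.Construct.Flip.EqAndOrd using () renaming (decTotalOrder to flipOrder)
open import Relation.Binary.PropositionalEquality
open import Relation.Nullary using (Dec; yes; no; does; ¬_; contradiction)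
open import Relation.Nullary.Decidable
  using (_×-dec_; _→-dec_; ¬?; map′; dec-true; dec-false; does-⇔; decidable-stable; dec⇒maybe)
open import Relation.Unary using (Pred; Decidable)
open import Algebra.Properties.CommutativeSemigroup ℕ.+-commutativeSemigroup using (x∙yz≈y∙xz)
open import Data.List.Sort (flipOrder ℕ.≤-decTotalOrder) using (sort; sort-↭; sort-↗)
open ≡-Reasoning

-- Set partitions are enumerated as sublists of `subsets n`, so the bijection for the slash product
-- has to become a statement about list order. It does: once the subsets that are empty or meet both
-- halves are discarded, `subsets (n + m)` reads as the embedded nonempty subsets of the left half
-- followed by those of the right half, and a sublist of a concatenation is a pair of sublists.
-- Multiplicativity of the Möbius function enters only in `expand-∣`, which holds for an arbitrary
-- function `h` of the block sizes; products and permutations of parts are then manipulations of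
-- nested finite sums. The value of `ρ (p σ)` is a double count of pairs of a word and a choice of
-- one letter per block: for a fixed word at most one choice fits, for a fixed choice exactly one
-- word. No formula for the inverse transition matrices is needed: a nonzero diagonal suffices,
-- since the linear systems are solved by an iteration that becomes stationary.

private variable
  A A′ A″ : Set
  n m k : ℕ

-- Indicators and finite sums of rationals

χ : Dec A → ℚ
χ d = if does d then 1ℚ else 0ℚ

χ-yes : (d : Dec A) → A → χ d ≡ 1ℚ
χ-yes d a = cong (if_then 1ℚ else 0ℚ) (dec-true d a)

χ-no : (d : Dec A) → ¬ A → χ d ≡ 0ℚ
χ-no d ¬a = cong (if_then 1ℚ else 0ℚ) (dec-false d ¬a)

χ-cong : (A → A′) → (A′ → A) → (d : Dec A) (d′ : Dec A′) → χ d ≡ χ d′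
χ-cong f g d d′ = cong (if_then 1ℚ else 0ℚ) (does-⇔ (mk⇔ f g) d d′)

χ-× : (d : Dec A) (d′ : Dec A′) → χ (d ×-dec d′) ≡ χ d * χ d′
χ-× (yes _) d′ = sym (ℚ.*-identityˡ (χ d′))
χ-× (no _)  d′ = sym (ℚ.*-zeroˡ (χ d′))

-- A term with a false guard is zero, so its other factor may be rewritten under the assumption that
-- the guard holds.
χ-guard : (d : Dec A) {q r : ℚ} → (A → q ≡ r) → χ d * q ≡ χ d * r
χ-guard (yes a) eq = cong (1ℚ *_) (eq a)
χ-guard (no _) {q} {r} eq = trans (ℚ.*-zeroˡ q) (sym (ℚ.*-zeroˡ r))

χ-guard-0 : (d : Dec A) {q : ℚ} → (A → q ≡ 0ℚ) → χ d * q ≡ 0ℚ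
χ-guard-0 d eq = trans (χ-guard d eq) (ℚ.*-zeroʳ (χ d))

interchange : ∀ p q r s → (p + q) + (r + s) ≡ (p + r) + (q + s)
interchange = solve 4 (λ p q r s → (p :+ q) :+ (r :+ s) := (p :+ r) :+ (q :+ s)) refl
  where open +-*-Solver

*-exchange : ∀ p q r → p * (q * r) ≡ q * (p * r)
*-exchange = solve 3 (λ p q r → p :* (q :* r) := q :* (p :* r)) refl
  where open +-*-Solver

infix 5 ∑
∑ : List A → (A → ℚ) → ℚ
∑ as f = sumℚ (map f as)

syntax ∑ as (λ a → e) = ∑[ a ∈ as ] e

∑-congᴬ : ∀ {f g : A → ℚ} {as} → All (λ a → f a ≡ g a) as → ∑ as f ≡ ∑ as g
∑-congᴬ []         = refl
∑-congᴬ (eq ∷ eqs) = cong₂ _+_ eq (∑-congᴬ eqs)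

∑-cong : ∀ {f g : A → ℚ} → (∀ a → f a ≡ g a) → ∀ as → ∑ as f ≡ ∑ as g
∑-cong eq as = ∑-congᴬ (All.universal eq as)

∑-zero : ∀ (as : List A) → ∑[ _ ∈ as ] 0ℚ ≡ 0ℚ
∑-zero []       = refl
∑-zero (a ∷ as) = trans (ℚ.+-identityˡ _) (∑-zero as)

∑-zeroᴬ : ∀ {f : A → ℚ} {as} → All (λ a → f a ≡ 0ℚ) as → ∑ as f ≡ 0ℚ
∑-zeroᴬ {as = as} eqs = trans (∑-congᴬ eqs) (∑-zero as)

∑-+ : ∀ (f g : A → ℚ) as → ∑[ a ∈ as ] (f a + g a) ≡ ∑ as f + ∑ as g
∑-+ f g []       = refl
∑-+ f g (a ∷ as) = trans (cong (f a + g a +_) (∑-+ f g as)) (interchange (f a) (g a) _ _)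

∑-*ˡ : ∀ c (f : A → ℚ) as → ∑[ a ∈ as ] (c * f a) ≡ c * ∑ as f
∑-*ˡ c f []       = sym (ℚ.*-zeroʳ c)
∑-*ˡ c f (a ∷ as) = trans (cong (c * f a +_) (∑-*ˡ c f as)) (sym (ℚ.*-distribˡ-+ c (f a) _))

∑-*ʳ : ∀ c (f : A → ℚ) as → ∑[ a ∈ as ] (f a * c) ≡ ∑ as f * c
∑-*ʳ c f as = begin
  ∑[ a ∈ as ] (f a * c)  ≡⟨ ∑-cong (λ a → ℚ.*-comm (f a) c) as ⟩
  ∑[ a ∈ as ] (c * f a)  ≡⟨ ∑-*ˡ c f as ⟩
  c * ∑ as f             ≡⟨ ℚ.*-comm c _ ⟩
  ∑ as f * c             ∎

∑-++ : ∀ (f : A → ℚ) as as′ → ∑ (as ++ as′) f ≡ ∑ as f + ∑ as′ f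
∑-++ f []       as′ = sym (ℚ.+-identityˡ _)
∑-++ f (a ∷ as) as′ = trans (cong (f a +_) (∑-++ f as as′)) (sym (ℚ.+-assoc (f a) _ _))

∑-map : ∀ (f : A′ → ℚ) (g : A → A′) as → ∑ (map g as) f ≡ ∑ as (f ∘ g)
∑-map f g as = cong sumℚ (sym (List.map-∘ as))

∑-swap : ∀ (f : A → A′ → ℚ) as bs → ∑[ a ∈ as ] ∑[ b ∈ bs ] f a b ≡ ∑[ b ∈ bs ] ∑[ a ∈ as ] f a b
∑-swap f []       bs = sym (∑-zero bs)
∑-swap f (a ∷ as) bs = trans (cong (∑ bs (f a) +_) (∑-swap f as bs)) (sym (∑-+ (f a) _ bs))

∑-↭ : ∀ (f : A → ℚ) {as as′} → as ↭ as′ → ∑ as f ≡ ∑ as′ f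
∑-↭ f Perm.refl         = refl
∑-↭ f (Perm.prep a p)   = cong (f a +_) (∑-↭ f p)
∑-↭ f (Perm.swap a b p) = trans (cong (λ s → f a + (f b + s)) (∑-↭ f p)) (exchange (f a) (f b) _)
  where
  exchange : ∀ p q r → p + (q + r) ≡ q + (p + r)
  exchange = solve 3 (λ p q r → p :+ (q :+ r) := q :+ (p :+ r)) refl where open +-*-Solver
∑-↭ f (Perm.trans p q)  = trans (∑-↭ f p) (∑-↭ f q)

∑-cartesianProductWith : ∀ (f : A″ → ℚ) (g : A → A′ → A″) as bs →
  ∑ (cartesianProductWith g as bs) f ≡ ∑[ a ∈ as ] ∑[ b ∈ bs ] f (g a b)
∑-cartesianProductWith f g []       bs = refl
∑-cartesianProductWith f g (a ∷ as) bs = trans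
  (∑-++ f (map (g a) bs) _)
  (cong₂ _+_ (∑-map f (g a) bs) (∑-cartesianProductWith f g as bs))

∑-filter : ∀ {P : Pred A 0ℓ} (P? : Decidable P) (f : A → ℚ) as →
  ∑ (filter P? as) f ≡ ∑[ a ∈ as ] χ (P? a) * f a
∑-filter P? f []       = refl
∑-filter P? f (a ∷ as) with does (P? a)
... | true  = cong₂ _+_ (sym (ℚ.*-identityˡ (f a))) (∑-filter P? f as)
... | false = trans (∑-filter P? f as)
                    (trans (sym (ℚ.+-identityˡ _)) (cong (_+ _) (sym (ℚ.*-zeroˡ (f a)))))

∑-single : ∀ {f : A → ℚ} {as a} → Unique as → a ∈ as →
  (∀ {b} → b ∈ as → b ≢ a → f b ≡ 0ℚ) → ∑ as f ≡ f a
∑-single {f = f} (a∉as ∷ _) (here refl) f≡0 = trans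
  (cong (f _ +_) (∑-zeroᴬ (All.tabulate λ b∈as → f≡0 (there b∈as) (All.lookup a∉as b∈as ∘ sym))))
  (ℚ.+-identityʳ _)
∑-single (b∉as ∷ as!) (there a∈as) f≡0 = trans
  (cong₂ _+_ (f≡0 (here refl) (All.lookup b∉as a∈as)) (∑-single as! a∈as (f≡0 ∘ there)))
  (ℚ.+-identityˡ _)

-- Products of power sums

infix 4 _≟ᴸ_
_≟ᴸ_ : (d e : List ℕ) → Dec (d ≡ e)
_≟ᴸ_ = List.≡-dec ℕ._≟_

zeros : ℕ → List ℕ
zeros k = replicate k 0

bumps : ℕ → List ℕ → List (List ℕ)
bumps a []      = []
bumps a (b ∷ c) = (a ℕ.+ b ∷ c) ∷ map (b ∷_) (bumps a c)

-- Multiplies the monomial with exponents `c` by the power sums of degrees `s` and applies to the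
-- result the linear functional with value `φ d` at exponents `d`. Arbitrary `φ` and `c` are what
-- make inductions on `s` go through.
spread : List ℕ → (List ℕ → ℚ) → List ℕ → ℚ
spread []      φ c = φ c
spread (a ∷ s) φ c = ∑ (bumps a c) (spread s φ)

-- The coefficient at e of the product of the power sums of degrees s: every
-- factor of degree a contributes some x_i^a, which adds a to one exponent.
powerSum : List ℕ → List ℕ → ℚ
powerSum s e = spread s (λ d → χ (d ≟ᴸ e)) (zeros (length e))

-- `I` is a loop invariant between the degrees still to be distributed and the exponents reached so
-- far, so `φ` and `ψ` need only agree on reachable exponents.
spread-cong : ∀ (I : List ℕ → List ℕ → Set) → (∀ {a s c} → I (a ∷ s) c → All (I s) (bumps a c)) →
  ∀ {φ ψ} → (∀ {d} → I [] d → φ d ≡ ψ d) → ∀ s {c} → I s c → spread s φ c ≡ spread s ψ c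
spread-cong I step eq []      i = eq i
spread-cong I step eq (a ∷ s) i = ∑-congᴬ (All.map (spread-cong I step eq s) (step i))

spread-ext : ∀ {φ ψ} → (∀ d → φ d ≡ ψ d) → ∀ s c → spread s φ c ≡ spread s ψ c
spread-ext eq []      c = eq c
spread-ext eq (a ∷ s) c = ∑-cong (spread-ext eq s) (bumps a c)

bumps-length : ∀ a c → All (λ d → length d ≡ length c) (bumps a c)
bumps-length a []      = []
bumps-length a (b ∷ c) = refl ∷ All.map⁺ (All.map (cong suc) (bumps-length a c))

bumps-sum : ∀ a c → All (λ d → sum d ≡ a ℕ.+ sum c) (bumps a c)
bumps-sum a []      = []
bumps-sum a (b ∷ c) =
  ℕ.+-assoc a b (sum c) ∷
  All.map⁺ (All.map (λ {d} eq → trans (cong (b ℕ.+_) eq) (x∙yz≈y∙xz b a (sum c))) (bumps-sum a c))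

spread-cong-length : ∀ {φ ψ} s c → (∀ d → length d ≡ length c → φ d ≡ ψ d) →
  spread s φ c ≡ spread s ψ c
spread-cong-length s c eq = spread-cong (λ _ d → length d ≡ length c)
  (λ {a} {_} {d} l → All.map (λ l′ → trans l′ l) (bumps-length a d)) (eq _) s refl

spread-∑ : ∀ (f : A → List ℕ → ℚ) as s c →
  spread s (λ d → ∑[ a ∈ as ] f a d) c ≡ ∑[ a ∈ as ] spread s (f a) c
spread-∑ f as []      c = refl
spread-∑ f as (a ∷ s) c = trans (∑-cong (spread-∑ f as s) (bumps a c)) (∑-swap _ (bumps a c) as)

spread-zero : ∀ s c → spread s (λ _ → 0ℚ) c ≡ 0ℚ
spread-zero []      c = refl
spread-zero (a ∷ s) c = trans (∑-cong (spread-zero s) (bumps a c)) (∑-zero (bumps a c))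

spread-*ˡ : ∀ r φ s c → spread s (λ d → r * φ d) c ≡ r * spread s φ c
spread-*ˡ r φ []      c = refl
spread-*ˡ r φ (a ∷ s) c = trans (∑-cong (spread-*ˡ r φ s) (bumps a c)) (∑-*ˡ r _ (bumps a c))

spread-*ʳ : ∀ r φ s c → spread s (λ d → φ d * r) c ≡ spread s φ c * r
spread-*ʳ r φ []      c = refl
spread-*ʳ r φ (a ∷ s) c = trans (∑-cong (spread-*ʳ r φ s) (bumps a c)) (∑-*ʳ r _ (bumps a c))

spread-++ : ∀ s t φ c → spread (s ++ t) φ c ≡ spread s (spread t φ) c
spread-++ []      t φ c = refl
spread-++ (a ∷ s) t φ c = ∑-cong (spread-++ s t φ) (bumps a c)

bumps-comm : ∀ a b (f : List ℕ → ℚ) c →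
  ∑[ d ∈ bumps a c ] ∑ (bumps b d) f ≡ ∑[ d ∈ bumps b c ] ∑ (bumps a d) f
bumps-comm a b f []      = refl
bumps-comm a b f (y ∷ c) = begin
  (f (b ℕ.+ (a ℕ.+ y) ∷ c) + ∑ (map (a ℕ.+ y ∷_) (bumps b c)) f) + ∑ (map (y ∷_) (bumps a c)) (λ d → ∑ (bumps b d) f)
    ≡⟨ cong₂ _+_ (cong₂ _+_ (cong (λ z → f (z ∷ c)) (x∙yz≈y∙xz b a y)) (∑-map f _ (bumps b c))) (inner a b) ⟩
  (f (a ℕ.+ (b ℕ.+ y) ∷ c) + X) + (Y + (∑[ d ∈ bumps a c ] ∑ (bumps b d) (f ∘ (y ∷_))))
    ≡⟨ cong (λ z → (f (a ℕ.+ (b ℕ.+ y) ∷ c) + X) + (Y + z)) (bumps-comm a b (f ∘ (y ∷_)) c) ⟩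
  (f (a ℕ.+ (b ℕ.+ y) ∷ c) + X) + (Y + (∑[ d ∈ bumps b c ] ∑ (bumps a d) (f ∘ (y ∷_))))
    ≡⟨ interchange (f (a ℕ.+ (b ℕ.+ y) ∷ c)) X Y _ ⟩
  (f (a ℕ.+ (b ℕ.+ y) ∷ c) + Y) + (X + (∑[ d ∈ bumps b c ] ∑ (bumps a d) (f ∘ (y ∷_))))
    ≡⟨ cong₂ _+_ (cong (f (a ℕ.+ (b ℕ.+ y) ∷ c) +_) (sym (∑-map f _ (bumps a c)))) (sym (inner b a)) ⟩
  (f (a ℕ.+ (b ℕ.+ y) ∷ c) + ∑ (map (b ℕ.+ y ∷_) (bumps a c)) f) + ∑ (map (y ∷_) (bumps b c)) (λ d → ∑ (bumps a d) f) ∎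
  where
  -- The mixed cases: `X` puts `a` on the head and `b` on the tail, `Y` the reverse. Exchanging `a`
  -- and `b` swaps them.
  X = ∑[ d ∈ bumps b c ] f (a ℕ.+ y ∷ d)
  Y = ∑[ d ∈ bumps a c ] f (b ℕ.+ y ∷ d)
  inner : ∀ a b → ∑ (map (y ∷_) (bumps a c)) (λ d → ∑ (bumps b d) f) ≡
    (∑[ d ∈ bumps a c ] f (b ℕ.+ y ∷ d)) + (∑[ d ∈ bumps a c ] ∑ (bumps b d) (f ∘ (y ∷_)))
  inner a b = trans (∑-map _ (y ∷_) (bumps a c)) (trans
    (∑-cong (λ d → cong (f (b ℕ.+ y ∷ d) +_) (∑-map f (y ∷_) (bumps b d))) (bumps a c))
    (∑-+ _ _ (bumps a c)))

spread-↭ : ∀ {s t} → s ↭ t → ∀ φ c → spread s φ c ≡ spread t φ c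
spread-↭ Perm.refl         φ c = refl
spread-↭ (Perm.prep a p)   φ c = ∑-cong (spread-↭ p φ) (bumps a c)
spread-↭ (Perm.swap a b p) φ c = trans
  (∑-cong (λ d → ∑-cong (spread-↭ p φ) (bumps b d)) (bumps a c))
  (bumps-comm a b _ c)
spread-↭ (Perm.trans p q)  φ c = trans (spread-↭ p φ c) (spread-↭ q φ c)

powerSum-↭ : ∀ {s t} → s ↭ t → ∀ e → powerSum s e ≡ powerSum t e
powerSum-↭ s↭t e = spread-↭ s↭t _ _

-- Homogeneity and symmetry of power sum products

sum-zeros : ∀ k → sum (zeros k) ≡ 0
sum-zeros zero    = refl
sum-zeros (suc k) = sum-zeros k

powerSum-homogeneous : ∀ s e → sum e ≢ sum s → powerSum s e ≡ 0ℚ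
powerSum-homogeneous s e e≢s = trans
  -- Invariant: the remaining degrees and the current exponents have a constant total.
  (spread-cong (λ t d → sum t ℕ.+ sum d ≡ sum s)
    (λ {a} {t} {d} eq → All.map (λ eq′ → trans (cong (sum t ℕ.+_) eq′) (trans (shift (sum t) a _) eq)) (bumps-sum a d))
    (λ {d} eq → χ-no (d ≟ᴸ e) (λ { refl → e≢s eq }))
    s (trans (cong (sum s ℕ.+_) (sum-zeros (length e))) (ℕ.+-identityʳ _)))
  (spread-zero s _)
  where
  shift : ∀ t a c → t ℕ.+ (a ℕ.+ c) ≡ a ℕ.+ t ℕ.+ c
  shift t a c = trans (sym (ℕ.+-assoc t a c)) (cong (ℕ._+ c) (ℕ.+-comm t a))

-- The rearrangement of positions underlying a permutation of a list,
-- applied to another list (of the same length).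
act : ∀ {e e′ : List ℕ} → e ↭ e′ → List ℕ → List ℕ
act Perm.refl         c           = c
act (Perm.prep _ p)   []          = []
act (Perm.prep _ p)   (y ∷ c)     = y ∷ act p c
act (Perm.swap _ _ p) []          = []
act (Perm.swap _ _ p) (y ∷ [])    = y ∷ []
act (Perm.swap _ _ p) (y ∷ z ∷ c) = z ∷ y ∷ act p c
act (Perm.trans p q)  c           = act q (act p c)

act-self : ∀ {e e′} (p : e ↭ e′) → act p e ≡ e′
act-self Perm.refl         = refl
act-self (Perm.prep y p)   = cong (y ∷_) (act-self p)
act-self (Perm.swap y z p) = cong (λ c → z ∷ y ∷ c) (act-self p)
act-self (Perm.trans p q)  = trans (cong (act q) (act-self p)) (act-self q)

act-sym : ∀ {e e′} (p : e ↭ e′) c → act (↭-sym p) (act p c) ≡ c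
act-sym Perm.refl         c           = refl
act-sym (Perm.prep _ p)   []          = refl
act-sym (Perm.prep _ p)   (y ∷ c)     = cong (y ∷_) (act-sym p c)
act-sym (Perm.swap _ _ p) []          = refl
act-sym (Perm.swap _ _ p) (y ∷ [])    = refl
act-sym (Perm.swap _ _ p) (y ∷ z ∷ c) = cong (λ c → y ∷ z ∷ c) (act-sym p c)
act-sym (Perm.trans p q)  c           = trans (cong (act (↭-sym p)) (act-sym q (act p c))) (act-sym p c)

act-zeros : ∀ {e e′} (p : e ↭ e′) k → act p (zeros k) ≡ zeros k
act-zeros Perm.refl         k             = refl
act-zeros (Perm.prep _ p)   zero          = refl
act-zeros (Perm.prep _ p)   (suc k)       = cong (0 ∷_) (act-zeros p k)
act-zeros (Perm.swap _ _ p) zero          = refl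
act-zeros (Perm.swap _ _ p) (suc zero)    = refl
act-zeros (Perm.swap _ _ p) (suc (suc k)) = cong (λ c → 0 ∷ 0 ∷ c) (act-zeros p k)
act-zeros (Perm.trans p q)  k             = trans (cong (act q) (act-zeros p k)) (act-zeros q k)

-- Only up to `↭`, because moving positions also changes the order in which `bumps` visits them;
-- sums do not see the difference.
act-bumps : ∀ {e e′} (p : e ↭ e′) a c → map (act p) (bumps a c) ↭ bumps a (act p c)
act-bumps Perm.refl         a c           = ↭-reflexive (List.map-id (bumps a c))
act-bumps (Perm.prep _ p)   a []          = ↭-refl
act-bumps (Perm.prep _ p)   a (y ∷ c)     = Perm.prep _ (↭-trans
  (↭-reflexive (trans (sym (List.map-∘ (bumps a c))) (List.map-∘ (bumps a c))))
  (Perm.map⁺ (y ∷_) (act-bumps p a c)))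
act-bumps (Perm.swap _ _ p) a []          = ↭-refl
act-bumps (Perm.swap _ _ p) a (y ∷ [])    = ↭-refl
act-bumps (Perm.swap y′ z′ p) a (y ∷ z ∷ c) = Perm.swap _ _ (begin′)
  where
  f = act (Perm.swap y′ z′ p)
  begin′ : map f (map (y ∷_) (map (z ∷_) (bumps a c))) ↭ map (z ∷_) (map (y ∷_) (bumps a (act p c)))
  begin′ = ↭-trans
    (↭-reflexive (trans (cong (map f) (sym (List.map-∘ (bumps a c))))
                 (trans (sym (List.map-∘ (bumps a c))) (List.map-∘ (bumps a c)))))
    (↭-trans (Perm.map⁺ (λ d → z ∷ y ∷ d) (act-bumps p a c)) (↭-reflexive (List.map-∘ _)))
act-bumps (Perm.trans p q)  a c           = ↭-trans
  (↭-reflexive (List.map-∘ (bumps a c)))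
  (↭-trans (Perm.map⁺ (act q) (act-bumps p a c)) (act-bumps q a (act p c)))

spread-act : ∀ {e e′} (p : e ↭ e′) s φ c → spread s (φ ∘ act p) c ≡ spread s φ (act p c)
spread-act p []      φ c = refl
spread-act p (a ∷ s) φ c = begin
  ∑ (bumps a c) (spread s (φ ∘ act p))  ≡⟨ ∑-cong (spread-act p s φ) (bumps a c) ⟩
  ∑ (bumps a c) (spread s φ ∘ act p)    ≡⟨ ∑-map _ (act p) (bumps a c) ⟨
  ∑ (map (act p) (bumps a c)) (spread s φ) ≡⟨ ∑-↭ _ (act-bumps p a c) ⟩
  ∑ (bumps a (act p c)) (spread s φ)    ∎

-- The rearrangement is carried from the target exponents to the starting exponents, which are all
-- zero and hence fixed by it.
powerSum-symmetric : ∀ s {e e′} → e ↭ e′ → powerSum s e ≡ powerSum s e′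
powerSum-symmetric s {e} {e′} p = begin
  spread s (λ d → χ (d ≟ᴸ e)) (zeros (length e))
    ≡⟨ spread-ext (λ d → χ-cong (λ { refl → act-self p })
         (λ eq → trans (sym (act-sym p d)) (trans (cong (act (↭-sym p)) eq) (act-self (↭-sym p))))
         (d ≟ᴸ e) (act p d ≟ᴸ e′)) s _ ⟩
  spread s (λ d → χ (act p d ≟ᴸ e′)) (zeros (length e))
    ≡⟨ spread-act p s _ _ ⟩
  spread s (λ d → χ (d ≟ᴸ e′)) (act p (zeros (length e)))
    ≡⟨ cong (spread s _) (trans (act-zeros p _) (cong zeros (Perm.↭-length p))) ⟩
  spread s (λ d → χ (d ≟ᴸ e′)) (zeros (length e′)) ∎

-- Multiplication of power sum products

infixl 6 _⊕_
_⊕_ : List ℕ → List ℕ → List ℕ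
_⊕_ = zipWith ℕ._+_

⊕-zeros : ∀ c → c ⊕ zeros (length c) ≡ c
⊕-zeros []      = refl
⊕-zeros (y ∷ c) = cong₂ _∷_ (ℕ.+-identityʳ y) (⊕-zeros c)

bumps-⊕ : ∀ a c d → length c ≡ length d → bumps a (c ⊕ d) ≡ map (c ⊕_) (bumps a d)
bumps-⊕ a []      []      _  = refl
bumps-⊕ a (y ∷ c) (z ∷ d) eq = cong₂ _∷_
  (cong (_∷ (c ⊕ d)) (x∙yz≈y∙xz a y z))
  (trans (cong (map (y ℕ.+ z ∷_)) (bumps-⊕ a c d (ℕ.suc-injective eq)))
         (trans (sym (List.map-∘ (bumps a d))) (List.map-∘ (bumps a d))))

-- Bumping is addition, so a fixed summand `c` can be added before the degrees are distributed
-- instead of after.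
spread-⊕ : ∀ s φ c d → length c ≡ length d → spread s (λ d → φ (c ⊕ d)) d ≡ spread s φ (c ⊕ d)
spread-⊕ []      φ c d eq = refl
spread-⊕ (a ∷ s) φ c d eq = begin
  ∑ (bumps a d) (spread s (λ d → φ (c ⊕ d)))
    ≡⟨ ∑-congᴬ (All.map (λ eq′ → spread-⊕ s φ c _ (trans eq (sym eq′))) (bumps-length a d)) ⟩
  ∑ (bumps a d) (λ d′ → spread s φ (c ⊕ d′)) ≡⟨ ∑-map _ (c ⊕_) (bumps a d) ⟨
  ∑ (map (c ⊕_) (bumps a d)) (spread s φ)    ≡⟨ cong (λ ds → ∑ ds (spread s φ)) (bumps-⊕ a c d eq) ⟨
  ∑ (bumps a (c ⊕ d)) (spread s φ)           ∎

factorisations-length : ∀ e →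
  All (λ (d , d′) → length d ≡ length e × length d′ ≡ length e) (factorisations e)
factorisations-length []      = (refl , refl) ∷ []
factorisations-length (a ∷ e) = All.cartesianProductWith⁺ (setoid _) (setoid _) _ (upTo (suc a)) (factorisations e)
  λ _ f → let l , l′ = All.lookup (factorisations-length e) f in cong suc l , cong suc l′

upTo-suc : ∀ k (f : ℕ → ℚ) → ∑ (upTo (suc k)) f ≡ f 0 + ∑ (upTo k) (f ∘ suc)
upTo-suc k f = cong (λ is → f 0 + sumℚ is) (trans (List.map-applyUpTo _ f k) (sym (List.map-applyUpTo _ (f ∘ suc) k)))

∑-upTo-single : ∀ {k i} {f : ℕ → ℚ} → i < k → (∀ j → j ≢ i → f j ≡ 0ℚ) → ∑ (upTo k) f ≡ f i
∑-upTo-single {k} i<k f≡0 = ∑-single (Unique.upTo⁺ k) (∈-upTo⁺ i<k) (λ _ → f≡0 _)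

-- Only the factorisation `(c , c′)` can contribute, and it occurs once or not at all, according to
-- whether the exponents add up to `e`.
∑-factorisations : ∀ e c c′ → length c ≡ length e → length c′ ≡ length e →
  ∑[ (d , d′) ∈ factorisations e ] χ (c ≟ᴸ d) * χ (c′ ≟ᴸ d′) ≡ χ (c ⊕ c′ ≟ᴸ e)
∑-factorisations []      []      []        _ _  = refl
∑-factorisations (a ∷ e) (y ∷ c) (y′ ∷ c′) l l′ = begin
  ∑[ (d , d′) ∈ factorisations (a ∷ e) ] χ (y ∷ c ≟ᴸ d) * χ (y′ ∷ c′ ≟ᴸ d′)
    ≡⟨ ∑-cartesianProductWith _ _ (upTo (suc a)) (factorisations e) ⟩
  ∑[ i ∈ upTo (suc a) ] ∑[ (d , d′) ∈ factorisations e ] χ (y ∷ c ≟ᴸ i ∷ d) * χ (y′ ∷ c′ ≟ᴸ (a ∸ i) ∷ d′)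
    ≡⟨ ∑-cong (λ i → trans (∑-cong (λ (d , d′) → split i d d′) (factorisations e)) (trans
         (∑-*ˡ (χ (y ℕ.≟ i) * χ (y′ ℕ.≟ a ∸ i)) _ (factorisations e))
         (cong (χ (y ℕ.≟ i) * χ (y′ ℕ.≟ a ∸ i) *_) (∑-factorisations e c c′ (ℕ.suc-injective l) (ℕ.suc-injective l′)))))
         (upTo (suc a)) ⟩
  ∑[ i ∈ upTo (suc a) ] (χ (y ℕ.≟ i) * χ (y′ ℕ.≟ a ∸ i)) * χ (c ⊕ c′ ≟ᴸ e)
    ≡⟨ ∑-*ʳ _ (λ i → χ (y ℕ.≟ i) * χ (y′ ℕ.≟ a ∸ i)) (upTo (suc a)) ⟩
  (∑[ i ∈ upTo (suc a) ] χ (y ℕ.≟ i) * χ (y′ ℕ.≟ a ∸ i)) * χ (c ⊕ c′ ≟ᴸ e)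
    ≡⟨ cong (_* χ (c ⊕ c′ ≟ᴸ e)) one ⟩
  χ (y ℕ.+ y′ ℕ.≟ a) * χ (c ⊕ c′ ≟ᴸ e)
    ≡⟨ ∷-χ (y ℕ.+ y′) a (c ⊕ c′) e ⟨
  χ ((y ∷ c) ⊕ (y′ ∷ c′) ≟ᴸ a ∷ e) ∎
  where
  ∷-χ : ∀ y z c d → χ (y ∷ c ≟ᴸ z ∷ d) ≡ χ (y ℕ.≟ z) * χ (c ≟ᴸ d)
  ∷-χ y z c d = trans
    (χ-cong List.∷-injective (λ { (refl , refl) → refl }) (y ∷ c ≟ᴸ z ∷ d) (y ℕ.≟ z ×-dec c ≟ᴸ d))
    (χ-× (y ℕ.≟ z) (c ≟ᴸ d))
  split : ∀ i d d′ → χ (y ∷ c ≟ᴸ i ∷ d) * χ (y′ ∷ c′ ≟ᴸ (a ∸ i) ∷ d′) ≡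
    (χ (y ℕ.≟ i) * χ (y′ ℕ.≟ a ∸ i)) * (χ (c ≟ᴸ d) * χ (c′ ≟ᴸ d′))
  split i d d′ = trans (cong₂ _*_ (∷-χ y i c d) (∷-χ y′ (a ∸ i) c′ d′))
                       (*-interchange (χ (y ℕ.≟ i)) (χ (c ≟ᴸ d)) (χ (y′ ℕ.≟ a ∸ i)) (χ (c′ ≟ᴸ d′)))
    where
    *-interchange : ∀ p q r s → (p * q) * (r * s) ≡ (p * r) * (q * s)
    *-interchange = solve 4 (λ p q r s → (p :* q) :* (r :* s) := (p :* r) :* (q :* s)) refl
      where open +-*-Solver
  one : ∑[ i ∈ upTo (suc a) ] χ (y ℕ.≟ i) * χ (y′ ℕ.≟ a ∸ i) ≡ χ (y ℕ.+ y′ ℕ.≟ a)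
  -- The bound is needed because `a ∸ y` truncates: for `y` above `a` the index `y` is out of range
  -- and both sides vanish.
  one with y ℕ.≤? a
  ... | yes y≤a = trans
    (∑-upTo-single (ℕ.s≤s y≤a)
      (λ i i≢y → trans (cong (_* χ (y′ ℕ.≟ a ∸ i)) (χ-no (y ℕ.≟ i) (i≢y ∘ sym)))
        (ℚ.*-zeroˡ (χ (y′ ℕ.≟ a ∸ i)))))
    (trans (cong (_* χ (y′ ℕ.≟ a ∸ y)) (χ-yes (y ℕ.≟ y) refl)) (trans (ℚ.*-identityˡ (χ (y′ ℕ.≟ a ∸ y)))
      (χ-cong (λ { refl → ℕ.m+[n∸m]≡n y≤a }) (λ { refl → sym (ℕ.m+n∸m≡n y y′) }) (y′ ℕ.≟ a ∸ y) (y ℕ.+ y′ ℕ.≟ a))))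
  ... | no y≰a = trans
    (∑-zeroᴬ (All.map (λ {i} i<1+a → trans (cong (_* χ (y′ ℕ.≟ a ∸ i)) (χ-no (y ℕ.≟ i) (λ { refl → y≰a (ℕ.≤-pred i<1+a) })))
        (ℚ.*-zeroˡ (χ (y′ ℕ.≟ a ∸ i)))) (All.all-upTo (suc a))))
    (sym (χ-no (y ℕ.+ y′ ℕ.≟ a) (λ { refl → y≰a (ℕ.m≤m+n y y′) })))

-- Each product of coefficients is a double `spread` from zero. Summing over factorisations fuses
-- the two indicators into one for `c ⊕ c′`, so the second `spread` simply continues where the first
-- one ends.
powerSum-* : ∀ s t e →
  ∑[ (d , d′) ∈ factorisations e ] powerSum s d * powerSum t d′ ≡ powerSum (s ++ t) e
powerSum-* s t e = begin
  ∑[ (d , d′) ∈ F ] powerSum s d * powerSum t d′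
    ≡⟨ ∑-congᴬ (All.map (λ {(d , d′)} (l , l′) → expand d d′ l l′) (factorisations-length e)) ⟩
  ∑[ (d , d′) ∈ F ] spread s (λ c → spread t (λ c′ → χ (c ≟ᴸ d) * χ (c′ ≟ᴸ d′)) 0ᵉ) 0ᵉ
    ≡⟨ spread-∑ _ F s 0ᵉ ⟨
  spread s (λ c → ∑[ (d , d′) ∈ F ] spread t (λ c′ → χ (c ≟ᴸ d) * χ (c′ ≟ᴸ d′)) 0ᵉ) 0ᵉ
    ≡⟨ spread-cong-length s 0ᵉ (λ c l → trans (sym (spread-∑ _ F t 0ᵉ)) (trans
         (spread-cong-length t 0ᵉ (λ c′ l′ → ∑-factorisations e c c′ (trans l len) (trans l′ len)))
         (trans (spread-⊕ t _ c 0ᵉ l) (cong (spread t _)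
           (trans (cong (λ k → c ⊕ zeros k) (sym (trans l len))) (⊕-zeros c)))))) ⟩
  spread s (spread t (λ d → χ (d ≟ᴸ e))) 0ᵉ
    ≡⟨ spread-++ s t _ 0ᵉ ⟨
  powerSum (s ++ t) e ∎
  where
  F  = factorisations e
  0ᵉ = zeros (length e)
  len : length 0ᵉ ≡ length e
  len = List.length-replicate (length e)
  expand : ∀ d d′ → length d ≡ length e → length d′ ≡ length e → powerSum s d * powerSum t d′ ≡
    spread s (λ c → spread t (λ c′ → χ (c ≟ᴸ d) * χ (c′ ≟ᴸ d′)) 0ᵉ) 0ᵉ
  expand d d′ l l′ rewrite l | l′ = trans
    (sym (spread-*ʳ _ _ s 0ᵉ))
    (spread-ext (λ c → sym (spread-*ˡ (χ (c ≟ᴸ d)) _ t 0ᵉ)) s 0ᵉ)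

-- Triangularity of power sum products against monomials

nonzeros : List ℕ → List ℕ
nonzeros = filter (0 ℕ.<?_)

-- A positive degree either lands on a zero exponent and creates a new part, or merges into an
-- existing one.
bumps-nonzeros : ∀ {a} → 0 < a → ∀ c →
  All (λ d → nonzeros d ↭ a ∷ nonzeros c ⊎ length (nonzeros d) ≡ length (nonzeros c)) (bumps a c)
bumps-nonzeros 0<a []            = []
bumps-nonzeros {suc a} 0<a (zero ∷ c)  =
  inj₁ (↭-reflexive (cong (λ b → suc b ∷ nonzeros c) (ℕ.+-identityʳ a))) ∷
  All.map⁺ (bumps-nonzeros 0<a c)
bumps-nonzeros {suc a} 0<a (suc b ∷ c) =
  inj₂ refl ∷
  All.map⁺ (All.map (λ { (inj₁ p) → inj₁ (↭-trans (Perm.prep _ p) (Perm.swap _ _ ↭-refl))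
                    ; (inj₂ eq) → inj₂ (cong suc eq) })
    (bumps-nonzeros 0<a c))

nonzeros-zeros : ∀ k → nonzeros (zeros k) ≡ []
nonzeros-zeros zero    = refl
nonzeros-zeros (suc k) = nonzeros-zeros k

-- As long as nothing has merged, the nonzero exponents and the remaining degrees together rearrange
-- `s`; a merge makes them fewer, and they stay fewer. Ending at `e` would therefore force `s ↭ e`
-- or `length e < length s`.
powerSum-triangular : ∀ {s e} → All (0 <_) s → All (0 <_) e → ¬ (s ↭ e) → ¬ (length e < length s) →
  powerSum s e ≡ 0ℚ
powerSum-triangular {s} {e} 0<s 0<e s≁e e≮s = trans
  (spread-cong I (λ {a} {t} {c} → step a t c) (λ {d} → final d) s
    (0<s , inj₁ (↭-reflexive (cong (_++ s) (nonzeros-zeros (length e))))))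
  (spread-zero s _)
  where
  I : List ℕ → List ℕ → Set
  I t d = All (0 <_) t × (nonzeros d ++ t ↭ s ⊎ length (nonzeros d ++ t) < length s)
  step : ∀ a t c → I (a ∷ t) c → All (I t) (bumps a c)
  step a t c (0<a ∷ 0<t , i) = All.map (λ {d} st → 0<t , go d i st) (bumps-nonzeros 0<a c)
    where
    moved : ∀ d → nonzeros d ↭ a ∷ nonzeros c → nonzeros d ++ t ↭ nonzeros c ++ a ∷ t
    moved d p = ↭-trans (Perm.++⁺ʳ t p) (↭-sym (Perm.shift a (nonzeros c) t))
    shorter : ∀ d → length (nonzeros d) ≡ length (nonzeros c) → length (nonzeros d ++ t) < length (nonzeros c ++ a ∷ t)
    shorter d eq = ℕ.≤-reflexive (trans (cong suc (trans (List.length-++ (nonzeros d))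
      (trans (cong (ℕ._+ length t) eq) (sym (List.length-++ (nonzeros c))))))
      (sym (Perm.↭-length (Perm.shift a (nonzeros c) t))))
    go : ∀ d → (nonzeros c ++ a ∷ t ↭ s ⊎ length (nonzeros c ++ a ∷ t) < length s) →
      nonzeros d ↭ a ∷ nonzeros c ⊎ length (nonzeros d) ≡ length (nonzeros c) →
      nonzeros d ++ t ↭ s ⊎ length (nonzeros d ++ t) < length s
    go d (inj₁ p) (inj₁ q)  = inj₁ (↭-trans (moved d q) p)
    go d (inj₂ l) (inj₁ q)  = inj₂ (subst (_< length s) (sym (Perm.↭-length (moved d q))) l)
    go d (inj₁ p) (inj₂ eq) = inj₂ (subst (length (nonzeros d ++ t) <_) (Perm.↭-length p) (shorter d eq))
    go d (inj₂ l) (inj₂ eq) = inj₂ (ℕ.<-trans (shorter d eq) l)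
  final : ∀ d → I [] d → χ (d ≟ᴸ e) ≡ 0ℚ
  final d (_ , i) = χ-no (d ≟ᴸ e) (λ { refl → bad i })
    where
    bad : ¬ (nonzeros e ++ [] ↭ s ⊎ length (nonzeros e ++ []) < length s)
    bad i with nonzeros e ++ [] | trans (List.++-identityʳ (nonzeros e)) (List.filter-all (0 ℕ.<?_) 0<e)
    bad (inj₁ p) | _ | refl = s≁e (↭-sym p)
    bad (inj₂ l) | _ | refl = e≮s l

∑-≥0 : ∀ {f : A → ℚ} → (∀ a → 0ℚ ℚ.≤ f a) → ∀ as → 0ℚ ℚ.≤ ∑ as f
∑-≥0 0≤f []       = ℚ.≤-refl
∑-≥0 0≤f (a ∷ as) = ℚ.+-mono-≤ (0≤f a) (∑-≥0 0≤f as)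

∑-mono : ∀ {f g : A → ℚ} → (∀ a → f a ℚ.≤ g a) → ∀ as → ∑ as f ℚ.≤ ∑ as g
∑-mono f≤g []       = ℚ.≤-refl
∑-mono f≤g (a ∷ as) = ℚ.+-mono-≤ (f≤g a) (∑-mono f≤g as)

spread-≥0 : ∀ {φ} → (∀ d → 0ℚ ℚ.≤ φ d) → ∀ s c → 0ℚ ℚ.≤ spread s φ c
spread-≥0 0≤φ []      c = 0≤φ c
spread-≥0 0≤φ (a ∷ s) c = ∑-≥0 (spread-≥0 0≤φ s) (bumps a c)

-- Leaving the head exponent untouched discards only nonnegative terms.
spread-∷-≤ : ∀ {φ} → (∀ d → 0ℚ ℚ.≤ φ d) → ∀ s y c → spread s (φ ∘ (y ∷_)) c ℚ.≤ spread s φ (y ∷ c)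
spread-∷-≤ 0≤φ []      y c = ℚ.≤-refl
spread-∷-≤ {φ} 0≤φ (a ∷ s) y c = ℚ.≤-trans
  (∑-mono (spread-∷-≤ 0≤φ s y) (bumps a c))
  (subst₂ ℚ._≤_ (ℚ.+-identityˡ (∑ (bumps a c) (spread s φ ∘ (y ∷_))))
    (cong (spread s φ (a ℕ.+ y ∷ c) +_) (sym (∑-map _ (y ∷_) (bumps a c))))
    (ℚ.+-monoˡ-≤ _ (spread-≥0 0≤φ s (a ℕ.+ y ∷ c))))

spread-zeros-≥ : ∀ {φ} → (∀ d → 0ℚ ℚ.≤ φ d) → ∀ s → φ s ℚ.≤ spread s φ (zeros (length s))
spread-zeros-≥ 0≤φ []      = ℚ.≤-refl
spread-zeros-≥ {φ} 0≤φ (a ∷ s) = ℚ.≤-trans (spread-zeros-≥ (λ d → 0≤φ (a ∷ d)) s) (ℚ.≤-trans (spread-∷-≤ 0≤φ s a 0ˢ′) (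
  subst₂ ℚ._≤_ (trans (ℚ.+-identityʳ (spread s φ (a ℕ.+ 0 ∷ 0ˢ′)))
    (cong (λ b → spread s φ (b ∷ 0ˢ′)) (ℕ.+-identityʳ a))) refl
   (ℚ.+-monoʳ-≤ (spread s φ (a ℕ.+ 0 ∷ 0ˢ′)) (∑-≥0 (spread-≥0 0≤φ s) (map (0 ∷_) (bumps a 0ˢ′))))))
  where 0ˢ′ = zeros (length s)

-- Sending the factors to distinct positions in order reaches `s` itself, and all other terms are
-- nonnegative, so the coefficient is at least `1`. For positive `s` its exact value is the product
-- of the factorials of the multiplicities, but a bound is enough.
powerSum-diagonal : ∀ s → powerSum s s ≢ 0ℚ
powerSum-diagonal s eq = contradiction
  (subst₂ ℚ._≤_ (χ-yes (s ≟ᴸ s) refl) eq (spread-zeros-≥ (λ d → χ-≥0 (d ≟ᴸ s)) s)) λ { (ℚ.*≤* (ℤ.+≤+ ())) }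
  where
  χ-≥0 : (d : Dec A) → 0ℚ ℚ.≤ χ d
  χ-≥0 (yes _) = ℚ.nonNegative⁻¹ 1ℚ
  χ-≥0 (no _)  = ℚ.≤-refl

-- Power sums in noncommuting variables

-- Nonemptiness is left out on purpose: deleting the first element of the ground set may empty a
-- block, and inductions on the ground set need a notion that `tails` preserves.
Exact : List (Subset n) → Set
Exact bs = AllPairs (λ B C → Empty (B ∩ C)) bs × (∀ i → Any (i ∈ˢ_) bs)

exact : (σ : SetPartition n) → Exact (blocks σ)
exact σ = let open IsSetPartition (isSetPartition σ) in disjoint , covering

sizes : List (Subset n) → List ℕ
sizes = map ∣_∣

tails : List (Subset (suc n)) → List (Subset n)
tails = map Vec.tail

exact-tails : ∀ {bs : List (Subset (suc n))} → Exact bs → Exact (tails bs)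
exact-tails (disj , cov) =
  AllPairs.map⁺ (AllPairs.map (λ {B} {C} → disjoint-tail B C) disj) ,
  λ i → Any.map⁺ (Any.map (λ {B} → ∈-tail B) (cov (Fin.suc i)))
  where
  ∈-tail : ∀ (B : Subset (suc n)) {i} → Fin.suc i ∈ˢ B → i ∈ˢ Vec.tail B
  ∈-tail (_ ∷ _) = drop-there
  disjoint-tail : ∀ (B C : Subset (suc n)) → Empty (B ∩ C) → Empty (Vec.tail B ∩ Vec.tail C)
  disjoint-tail (_ ∷ B) (_ ∷ C) e (i , h) = e (Fin.suc i , there h)

-- Points at the one block that holds the first element; earlier blocks are `outside`, and later
-- ones avoid it by disjointness.
data HeadIn {n} : List (Subset (suc n)) → Set where
  this : ∀ {B bs} → All (Fin.zero ∉ˢ_) bs → HeadIn ((inside ∷ B) ∷ bs)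
  next : ∀ {B bs} → HeadIn bs → HeadIn ((outside ∷ B) ∷ bs)

exact⇒headIn : ∀ {bs : List (Subset (suc n))} → Exact bs → HeadIn bs
exact⇒headIn (disj , cov) = go disj (cov Fin.zero)
  where
  go : ∀ {bs : List (Subset (suc n))} → AllPairs (λ B C → Empty (B ∩ C)) bs → Any (Fin.zero ∈ˢ_) bs → HeadIn bs
  go {bs = (true ∷ B) ∷ bs} (d ∷ _) _ = this (All.map (λ e h → e (Fin.zero , x∈p∩q⁺ (here , h))) d)
  go {bs = (false ∷ B) ∷ bs} (_ ∷ ds) (there h) = next (go ds h)

sizes-headless : ∀ {bs : List (Subset (suc n))} → All (Fin.zero ∉ˢ_) bs → sizes bs ≡ sizes (tails bs)
sizes-headless []                             = refl
sizes-headless (_∷_ {true ∷ B} 0∉B _)         = contradiction here 0∉B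
sizes-headless (_∷_ {false ∷ B} _ ∉bs)        = cong (∣ B ∣ ∷_) (sizes-headless ∉bs)

sum-sizes-headIn : ∀ {bs : List (Subset (suc n))} → HeadIn bs → sum (sizes bs) ≡ suc (sum (sizes (tails bs)))
sum-sizes-headIn (this {B} ∉bs) = cong (λ s → suc (∣ B ∣ ℕ.+ sum s)) (sizes-headless ∉bs)
sum-sizes-headIn (next {B} h)   = trans (cong (∣ B ∣ ℕ.+_) (sum-sizes-headIn h)) (ℕ.+-suc ∣ B ∣ _)

sum-sizes : ∀ {bs : List (Subset n)} → Exact bs → sum (sizes bs) ≡ n
sum-sizes {zero} {bs} _  = empties bs
  where
  empties : (bs : List (Subset 0)) → sum (sizes bs) ≡ 0
  empties []        = refl
  empties ([] ∷ bs) = empties bs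
sum-sizes {suc n}     ex = trans (sum-sizes-headIn (exact⇒headIn ex)) (cong suc (sum-sizes (exact-tails ex)))

-- One position of `bumps`, addressed by index. Out of range it does nothing, so commutation holds
-- without bounds.
bump : ℕ → ℕ → List ℕ → List ℕ
bump i       a []      = []
bump zero    a (b ∷ c) = a ℕ.+ b ∷ c
bump (suc i) a (b ∷ c) = b ∷ bump i a c

bump-0 : ∀ i c → bump i 0 c ≡ c
bump-0 i       []      = refl
bump-0 zero    (b ∷ c) = refl
bump-0 (suc i) (b ∷ c) = cong (b ∷_) (bump-0 i c)

bump-suc : ∀ i a c → bump i (suc a) c ≡ bump i 1 (bump i a c)
bump-suc i       a []      = refl
bump-suc zero    a (b ∷ c) = refl
bump-suc (suc i) a (b ∷ c) = cong (b ∷_) (bump-suc i a c)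

bump-comm : ∀ i a j b c → bump i a (bump j b c) ≡ bump j b (bump i a c)
bump-comm i       a j       b []      = refl
bump-comm zero    a zero    b (y ∷ c) = cong (_∷ c) (x∙yz≈y∙xz a b y)
bump-comm zero    a (suc j) b (y ∷ c) = refl
bump-comm (suc i) a zero    b (y ∷ c) = refl
bump-comm (suc i) a (suc j) b (y ∷ c) = cong (y ∷_) (bump-comm i a j b c)

bump-length : ∀ i a c → length (bump i a c) ≡ length c
bump-length i       a []      = refl
bump-length zero    a (b ∷ c) = refl
bump-length (suc i) a (b ∷ c) = cong suc (bump-length i a c)

∑-bumps : ∀ a c (f : List ℕ → ℚ) → ∑ (bumps a c) f ≡ ∑[ i ∈ upTo (length c) ] f (bump i a c)
∑-bumps a []      f = refl
∑-bumps a (b ∷ c) f = trans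
  (cong (f (a ℕ.+ b ∷ c) +_) (trans (∑-map f (b ∷_) (bumps a c)) (∑-bumps a c (f ∘ (b ∷_)))))
  (sym (upTo-suc (length c) (λ i → f (bump i a (b ∷ c)))))

spread-bump : ∀ i a s φ c → spread s (φ ∘ bump i a) c ≡ spread s φ (bump i a c)
spread-bump i a []      φ c = refl
spread-bump i a (b ∷ s) φ c = begin
  ∑ (bumps b c) (spread s (φ ∘ bump i a))
    ≡⟨ trans (∑-cong (spread-bump i a s φ) (bumps b c)) (∑-bumps b c _) ⟩
  ∑[ j ∈ upTo (length c) ] spread s φ (bump i a (bump j b c))
    ≡⟨ ∑-cong (λ j → cong (spread s φ) (bump-comm i a j b c)) (upTo (length c)) ⟩
  ∑[ j ∈ upTo (length c) ] spread s φ (bump j b (bump i a c))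
    ≡⟨ cong (λ l → ∑[ j ∈ upTo l ] spread s φ (bump j b (bump i a c))) (bump-length i a c) ⟨
  ∑[ j ∈ upTo (length (bump i a c)) ] spread s φ (bump j b (bump i a c))
    ≡⟨ ∑-bumps b (bump i a c) _ ⟨
  ∑ (bumps b (bump i a c)) (spread s φ) ∎

-- Exponents of the monomial x_{v₁}^{s₁} x_{v₂}^{s₂} ⋯ in k variables.
content : ℕ → List ℕ → List ℕ → List ℕ
content k (a ∷ s) (i ∷ v) = bump i a (content k s v)
content k _       _       = zeros k

∑-words-suc : ∀ k n (f : List ℕ → ℚ) →
  ∑ (words k (suc n)) f ≡ ∑[ i ∈ upTo k ] ∑[ w ∈ words k n ] f (i ∷ w)
∑-words-suc k n f = ∑-cartesianProductWith f _∷_ (upTo k) (words k n)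

-- A word `v` chooses a variable for every power sum factor. `content` performs the first choice
-- last while `spread` performs it first; `spread-bump` reconciles the two orders.
∑-content : ∀ k s φ → ∑[ v ∈ words k (length s) ] φ (content k s v) ≡ spread s φ (zeros k)
∑-content k []      φ = ℚ.+-identityʳ _
∑-content k (a ∷ s) φ = begin
  ∑[ v ∈ words k (suc (length s)) ] φ (content k (a ∷ s) v)
    ≡⟨ ∑-words-suc k (length s) _ ⟩
  ∑[ i ∈ upTo k ] ∑[ v ∈ words k (length s) ] φ (bump i a (content k s v))
    ≡⟨ ∑-cong (λ i → trans (∑-content k s (φ ∘ bump i a)) (spread-bump i a s φ (zeros k))) (upTo k) ⟩
  ∑[ i ∈ upTo k ] spread s φ (bump i a (zeros k))
    ≡⟨ cong (λ l → ∑[ i ∈ upTo l ] spread s φ (bump i a (zeros k))) (List.length-replicate k) ⟨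
  ∑[ i ∈ upTo (length (zeros k)) ] spread s φ (bump i a (zeros k))
    ≡⟨ ∑-bumps a (zeros k) _ ⟨
  spread (a ∷ s) φ (zeros k) ∎

words-valid : ∀ k n → All (λ w → length w ≡ n × All (_< k) w) (words k n)
words-valid k zero    = (refl , []) ∷ []
words-valid k (suc n) = All.cartesianProductWith⁺ (setoid _) (setoid _) _∷_ (upTo k) (words k n)
  λ i∈ w∈ → let l , w<k = All.lookup (words-valid k n) w∈ in cong suc l , All.lookup (All.all-upTo k) i∈ ∷ w<k

applyUpTo-bump : ∀ (f g : ℕ → ℕ) a → g a ≡ suc (f a) → (∀ i → i ≢ a → g i ≡ f i) →
  ∀ k → applyUpTo g k ≡ bump a 1 (applyUpTo f k)
applyUpTo-bump f g a       ga gi zero    = refl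
applyUpTo-bump f g zero    ga gi (suc k) = cong₂ _∷_ ga (applyUpTo-cong (λ i → gi (suc i) λ ()) k)
  where
  applyUpTo-cong : ∀ {f g : ℕ → ℕ} → (∀ i → f i ≡ g i) → ∀ k → applyUpTo f k ≡ applyUpTo g k
  applyUpTo-cong eq zero    = refl
  applyUpTo-cong eq (suc k) = cong₂ _∷_ (eq 0) (applyUpTo-cong (eq ∘ suc) k)
applyUpTo-bump f g (suc a) ga gi (suc k) = cong₂ _∷_ (gi 0 λ ())
  (applyUpTo-bump (f ∘ suc) (g ∘ suc) a ga (λ i i≢a → gi (suc i) (i≢a ∘ ℕ.suc-injective)) k)

exponents-∷ : ∀ k a w → exponents k (a ∷ w) ≡ bump a 1 (exponents k w)
exponents-∷ k a w = begin
  exponents k (a ∷ w)                        ≡⟨ List.map-upTo (occurrences (a ∷ w)) k ⟩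
  applyUpTo (occurrences (a ∷ w)) k          ≡⟨ applyUpTo-bump (occurrences w) (occurrences (a ∷ w)) a
    (cong length (List.filter-accept (a ℕ.≟_) {xs = w} refl))
    (λ i i≢a → cong length (List.filter-reject (i ℕ.≟_) {xs = w} i≢a)) k ⟩
  bump a 1 (applyUpTo (occurrences w) k)     ≡⟨ cong (bump a 1) (List.map-upTo (occurrences w) k) ⟨
  bump a 1 (exponents k w)                   ∎

exponents-[] : ∀ k → exponents k [] ≡ zeros k
exponents-[] k = trans (map-zero (upTo k)) (cong zeros (List.length-upTo k))
  where
  map-zero : (is : List ℕ) → map (λ _ → 0) is ≡ zeros (length is)
  map-zero []       = refl
  map-zero (_ ∷ is) = cong (0 ∷_) (map-zero is)

-- Counting words and letter choices that match

on : Subset n → ℕ → List ℕ → ℚ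
on []            i w       = 1ℚ
on (_ ∷ _)       i []      = 0ℚ
on (inside ∷ B)  i (a ∷ w) = χ (a ℕ.≟ i) * on B i w
on (outside ∷ B) i (a ∷ w) = on B i w

-- Indicator that `w` carries the letter `i` of `v` throughout the corresponding block. It is a
-- product of indicators per position, so that the first position can be split off.
match : List (Subset n) → List ℕ → List ℕ → ℚ
match []       v       w = 1ℚ
match (B ∷ bs) []      w = 0ℚ
match (B ∷ bs) (i ∷ v) w = on B i w * match bs v w

match-headless : ∀ {bs : List (Subset (suc n))} → All (Fin.zero ∉ˢ_) bs →
  ∀ v a w → match bs v (a ∷ w) ≡ match (tails bs) v w
match-headless []                      v       a w = refl
match-headless (_∷_ {true ∷ B} 0∉B _)  v       a w = contradiction here 0∉B
match-headless (_∷_ {false ∷ B} _ ∉bs) []      a w = refl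
match-headless (_∷_ {false ∷ B} _ ∉bs) (i ∷ v) a w = cong (on B i w *_) (match-headless ∉bs v a w)

-- The letter `i` chosen for the block holding the first position is forced to be the first letter
-- of a matching word, and removing that position takes one `i` out of the content.
headLetter : ∀ {bs : List (Subset (suc n))} → HeadIn bs → ∀ {v} → length v ≡ length bs → All (_< k) v →
  ∃ λ i → i < k × (∀ a w → match bs v (a ∷ w) ≡ χ (a ℕ.≟ i) * match (tails bs) v w)
                × content k (sizes bs) v ≡ bump i 1 (content k (sizes (tails bs)) v)
headLetter {k = k} (this {B} ∉bs) {i ∷ v} l (i<k ∷ _) = i , i<k ,
  (λ a w → trans (cong (on (inside ∷ B) i (a ∷ w) *_) (match-headless ∉bs v a w)) (ℚ.*-assoc (χ (a ℕ.≟ i)) (on B i w) _)) ,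
  trans (cong (λ s → bump i (suc ∣ B ∣) (content k s v)) (sizes-headless ∉bs)) (bump-suc i ∣ B ∣ _)
headLetter (next {B} h) {j ∷ v} l (_ ∷ v<k) with headLetter h (ℕ.suc-injective l) v<k
... | i , i<k , m , c = i , i<k ,
  (λ a w → trans (cong (on B j w *_) (m a w)) (*-exchange (on B j w) (χ (a ℕ.≟ i)) _)) ,
  trans (cong (bump j ∣ B ∣) c) (bump-comm j ∣ B ∣ i 1 _)

-- Once the blocks have their letters, exactly one word matches. Its first letter is forced, and the
-- general `φ` absorbs the bump which that letter causes.
∑-match : ∀ {bs : List (Subset n)} → Exact bs → ∀ {v} → length v ≡ length bs → All (_< k) v →
  ∀ (φ : List ℕ → ℚ) → ∑[ w ∈ words k n ] match bs v w * φ (exponents k w) ≡ φ (content k (sizes bs) v)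
∑-match {zero} {k} {bs} ex {v} l v<k φ = begin
  match bs v [] * φ (exponents k []) + 0ℚ  ≡⟨ ℚ.+-identityʳ (match bs v [] * φ (exponents k [])) ⟩
  match bs v [] * φ (exponents k [])       ≡⟨ cong₂ _*_ (match-[] bs v l) (cong φ (exponents-[] k)) ⟩
  1ℚ * φ (zeros k)                         ≡⟨ ℚ.*-identityˡ _ ⟩
  φ (zeros k)                              ≡⟨ cong φ (content-0 bs v) ⟨
  φ (content k (sizes bs) v)               ∎
  where
  match-[] : ∀ (bs : List (Subset 0)) v → length v ≡ length bs → match bs v [] ≡ 1ℚ
  match-[] []        v       l = refl
  match-[] ([] ∷ bs) (i ∷ v) l = trans (ℚ.*-identityˡ (match bs v [])) (match-[] bs v (ℕ.suc-injective l))
  content-0 : ∀ (bs : List (Subset 0)) v → content k (sizes bs) v ≡ zeros k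
  content-0 []        v       = refl
  content-0 ([] ∷ bs) []      = refl
  content-0 ([] ∷ bs) (i ∷ v) = trans (bump-0 i _) (content-0 bs v)
∑-match {suc n} {k} {bs} ex {v} l v<k φ with headLetter (exact⇒headIn ex) l v<k
... | i , i<k , m , c = begin
  ∑[ w ∈ words k (suc n) ] match bs v w * φ (exponents k w)
    ≡⟨ ∑-words-suc k n _ ⟩
  ∑[ a ∈ upTo k ] ∑[ w ∈ words k n ] match bs v (a ∷ w) * φ (exponents k (a ∷ w))
    ≡⟨ ∑-cong (λ a → trans
         (∑-cong (λ w → trans (cong₂ _*_ (m a w) (cong φ (exponents-∷ k a w)))
           (ℚ.*-assoc (χ (a ℕ.≟ i)) (match (tails bs) v w) _)) (words k n))
         (∑-*ˡ (χ (a ℕ.≟ i)) _ (words k n))) (upTo k) ⟩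
  ∑[ a ∈ upTo k ] χ (a ℕ.≟ i) * (∑[ w ∈ words k n ] match (tails bs) v w * φ (bump a 1 (exponents k w)))
    ≡⟨ ∑-cong (λ a → cong (χ (a ℕ.≟ i) *_)
         (∑-match (exact-tails ex) (trans l (sym (List.length-map Vec.tail bs))) v<k (φ ∘ bump a 1)))
         (upTo k) ⟩
  ∑[ a ∈ upTo k ] χ (a ℕ.≟ i) * φ (bump a 1 (content k (sizes (tails bs)) v))
    ≡⟨ ∑-upTo-single i<k
         (λ a a≢i → trans (cong (_* φ (bump a 1 (content k (sizes (tails bs)) v))) (χ-no (a ℕ.≟ i) a≢i))
           (ℚ.*-zeroˡ (φ (bump a 1 (content k (sizes (tails bs)) v))))) ⟩
  χ (i ℕ.≟ i) * φ (bump i 1 (content k (sizes (tails bs)) v))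
    ≡⟨ trans (cong₂ _*_ (χ-yes (i ℕ.≟ i) refl) (cong φ (sym c))) (ℚ.*-identityˡ _) ⟩
  φ (content k (sizes bs) v) ∎

on-yes : ∀ w (B : Subset (length w)) {i} → (∀ j → j ∈ˢ B → lookup w j ≡ i) → on B i w ≡ 1ℚ
on-yes []      []            eq = refl
on-yes (a ∷ w) (true ∷ B)    {i} eq = cong₂ _*_ (χ-yes (a ℕ.≟ i) (eq Fin.zero here))
  (on-yes w B (λ j h → eq (Fin.suc j) (there h)))
on-yes (a ∷ w) (false ∷ B)   eq = on-yes w B (λ j h → eq (Fin.suc j) (there h))

on-no : ∀ w (B : Subset (length w)) {i j} → j ∈ˢ B → lookup w j ≢ i → on B i w ≡ 0ℚ
on-no (a ∷ w) (_ ∷ B)     {i} here      ≢i = trans (cong (_* on B i w) (χ-no (a ℕ.≟ i) ≢i)) (ℚ.*-zeroˡ (on B i w))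
on-no (a ∷ w) (true ∷ B)  {i} (there h) ≢i = trans (cong (χ (a ℕ.≟ i) *_) (on-no w B h ≢i)) (ℚ.*-zeroʳ (χ (a ℕ.≟ i)))
on-no (a ∷ w) (false ∷ B) (there h) ≢i = on-no w B h ≢i

ConstantOn : (w : List ℕ) → Subset (length w) → Set
ConstantOn w B = ∀ i j → i ∈ˢ B → j ∈ˢ B → lookup w i ≡ lookup w j

Varies : (w : List ℕ) → Subset (length w) → Set
Varies w B = ∃₂ λ i j → i ∈ˢ B × j ∈ˢ B × lookup w i ≢ lookup w j

constant⊎varies : ∀ w {B : Subset (length w)} → ConstantOn w B ⊎ Varies w B
constant⊎varies w {B} = decide (Fin.all? λ i → Fin.all? (equal? i))
  where
  equal? : ∀ i j → Dec (i ∈ˢ B → j ∈ˢ B → lookup w i ≡ lookup w j)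
  equal? i j = (i ∈? B) →-dec ((j ∈? B) →-dec (lookup w i ℕ.≟ lookup w j))
  decide : Dec (ConstantOn w B) → ConstantOn w B ⊎ Varies w B
  decide (yes c) = inj₁ c
  decide (no ¬c) =
    let i , ¬cᵢ  = Fin.¬∀⟶∃¬ _ _ (λ i → Fin.all? (equal? i)) ¬c
        j , ¬cᵢⱼ = Fin.¬∀⟶∃¬ _ _ (equal? i) ¬cᵢ
    in inj₂ (i , j ,
      decidable-stable (i ∈? B) (λ i∉B → ¬cᵢⱼ (λ i∈B → contradiction i∈B i∉B)) ,
      decidable-stable (j ∈? B) (λ j∉B → ¬cᵢⱼ (λ _ j∈B → contradiction j∈B j∉B)) ,
      λ eq → ¬cᵢⱼ (λ _ _ → eq))

∑-on-constant : ∀ w → All (_< k) w → ∀ {B} → Nonempty B → ConstantOn w B → ∑[ i ∈ upTo k ] on B i w ≡ 1ℚ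
∑-on-constant w w<k {B} (j , j∈B) c = trans
  (∑-upTo-single (All.lookup w<k (∈-lookup j)) (λ i i≢ → on-no w B j∈B (i≢ ∘ sym)))
  (on-yes w B (λ i i∈B → c i j i∈B j∈B))

∑-on-varies : ∀ k w {B} → Varies w B → ∑[ i ∈ upTo k ] on B i w ≡ 0ℚ
∑-on-varies k w {B} (i , j , i∈B , j∈B , i≢j) = ∑-zeroᴬ (All.universal on≡0 (upTo k))
  where
  on≡0 : ∀ a → on B a w ≡ 0ℚ
  on≡0 a = decide (lookup w i ℕ.≟ a)
    where
    decide : Dec (lookup w i ≡ a) → on B a w ≡ 0ℚ
    decide (yes eq) = on-no w B j∈B (λ eq′ → i≢j (trans eq (sym eq′)))
    decide (no ≢a)  = on-no w B i∈B ≢a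

∑-match-∷ : ∀ k (B : Subset n) bs w →
  ∑[ v ∈ words k (suc (length bs)) ] match (B ∷ bs) v w ≡
  (∑[ i ∈ upTo k ] on B i w) * (∑[ v ∈ words k (length bs) ] match bs v w)
∑-match-∷ k B bs w = trans (∑-words-suc k (length bs) _) (trans
  (∑-cong (λ i → ∑-*ˡ (on B i w) _ (words k (length bs))) (upTo k))
  (∑-*ʳ _ (λ i → on B i w) (upTo k)))

-- A word constant on every block determines the letter choice, since each block has an element to
-- read it from; an empty block would instead match all `k` letters.
∑-matches : ∀ w → All (_< k) w → ∀ {bs} → All Nonempty bs →
  (All (ConstantOn w) bs × ∑[ v ∈ words k (length bs) ] match bs v w ≡ 1ℚ) ⊎
  (Any (Varies w) bs × ∑[ v ∈ words k (length bs) ] match bs v w ≡ 0ℚ)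
∑-matches w w<k [] = inj₁ ([] , refl)
∑-matches {k} w w<k {B ∷ bs} (ne ∷ nes) with constant⊎varies w {B} | ∑-matches w w<k nes
... | inj₁ c | inj₁ (cs , eqs) = inj₁ (c ∷ cs , trans (∑-match-∷ k B bs w) (cong₂ _*_ (∑-on-constant w w<k ne c) eqs))
... | inj₁ c | inj₂ (vs , eqs) = inj₂ (there vs ,
  trans (∑-match-∷ k B bs w)
    (trans (cong ((∑[ i ∈ upTo k ] on B i w) *_) eqs)
      (ℚ.*-zeroʳ (∑[ i ∈ upTo k ] on B i w))))
... | inj₂ v | _               = inj₂ (here v ,
  trans (∑-match-∷ k B bs w)
    (trans (cong (_* _) (∑-on-varies k w v)) (ℚ.*-zeroˡ (∑[ v ∈ words k (length bs) ] match bs v w))))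

p-length : ∀ {n} (σ : SetPartition n) {w} → length w ≢ n → p σ w ≡ 0ℚ
p-length {n} σ {w} l≢n with length w ℕ.≟ n
... | yes l≡n = contradiction l≡n l≢n
... | no _    = refl

p-χ : ∀ w (σ : SetPartition (length w)) → p σ w ≡ χ (constantOnBlocks? w σ)
p-χ w σ with length w ℕ.≟ length w
... | yes refl = refl
... | no ≢     = contradiction refl ≢

p-match : ∀ (σ : SetPartition n) {w} → length w ≡ n → All (_< k) w →
  p σ w ≡ ∑[ v ∈ words k (length (blocks σ)) ] match (blocks σ) v w
p-match σ {w} refl w<k with ∑-matches w w<k (IsSetPartition.nonempty (isSetPartition σ))
... | inj₁ (cs , eq) = trans (p-χ w σ) (trans
  (χ-yes (constantOnBlocks? w σ) λ i j h → let c , i∈ , j∈ = All.lookupAny cs h in c i j i∈ j∈)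
  (sym eq))
... | inj₂ (vs , eq) = trans (p-χ w σ) (trans
  (χ-no (constantOnBlocks? w σ) λ c → let _ , B∈ , i , j , i∈ , j∈ , i≢j = find vs in
    i≢j (c i j (Any.map (λ { refl → i∈ , j∈ }) B∈)))
  (sym eq))

ρ-words : ∀ F e → coeff (ρ F) e ≡ ∑[ w ∈ words (length e) (sum e) ] χ (exponents (length e) w ≟ᴸ e) * F w
ρ-words F e = ∑-filter (λ w → exponents (length e) w ≟ᴸ e) F (words (length e) (sum e))

ρ-p : ∀ (σ : SetPartition n) e → coeff (ρ (p σ)) e ≡ powerSum (sizes (blocks σ)) e
ρ-p {n} σ e with sum e ℕ.≟ n
... | no ≢n = trans (ρ-words (p σ) e) (trans
  (∑-zeroᴬ (All.map (λ {w} (l , _) → trans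
      (cong (χ (exponents (length e) w ≟ᴸ e) *_) (p-length σ {w} (λ eq → ≢n (trans (sym l) eq))))
      (ℚ.*-zeroʳ (χ (exponents (length e) w ≟ᴸ e))))
    (words-valid (length e) (sum e))))
  (sym (powerSum-homogeneous (sizes (blocks σ)) e λ eq → ≢n (trans eq (sum-sizes (exact σ))))))
... | yes refl = begin
  coeff (ρ (p σ)) e
    ≡⟨ ρ-words (p σ) e ⟩
  ∑[ w ∈ W ] χ (exponents k₀ w ≟ᴸ e) * p σ w
    ≡⟨ ∑-congᴬ (All.map (λ {w} (l , w<k) → trans (cong (χ (exponents k₀ w ≟ᴸ e) *_) (p-match σ l w<k))
         (trans (ℚ.*-comm (χ (exponents k₀ w ≟ᴸ e)) _)
         (sym (∑-*ʳ (χ (exponents k₀ w ≟ᴸ e)) _ V)))) (words-valid k₀ (sum e))) ⟩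
  ∑[ w ∈ W ] ∑[ v ∈ V ] match bs v w * χ (exponents k₀ w ≟ᴸ e)
    -- The double count: summing over letter choices first gave `p σ w`; summing over words first
    -- gives one term per letter choice.
    ≡⟨ ∑-swap _ W V ⟩
  ∑[ v ∈ V ] ∑[ w ∈ W ] match bs v w * χ (exponents k₀ w ≟ᴸ e)
    ≡⟨ ∑-congᴬ (All.map (λ (l , v<k) → ∑-match (exact σ) l v<k (λ d → χ (d ≟ᴸ e))) (words-valid k₀ (length bs))) ⟩
  ∑[ v ∈ V ] χ (content k₀ (sizes bs) v ≟ᴸ e)
    ≡⟨ cong (λ l → ∑[ v ∈ words k₀ l ] χ (content k₀ (sizes bs) v ≟ᴸ e)) (List.length-map ∣_∣ bs) ⟨
  ∑[ v ∈ words k₀ (length (sizes bs)) ] χ (content k₀ (sizes bs) v ≟ᴸ e)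
    ≡⟨ ∑-content k₀ (sizes bs) _ ⟩
  powerSum (sizes bs) e ∎
  where
  k₀  = length e
  bs = blocks σ
  W  = words k₀ (sum e)
  V  = words k₀ (length bs)

-- Set partitions below a slash product

∑⊆ : List A → (List A → ℚ) → ℚ
∑⊆ as = ∑ (sublists as)

∑⊆-∷ : ∀ (a : A) as G → ∑⊆ (a ∷ as) G ≡ ∑⊆ as (G ∘ (a ∷_)) + ∑⊆ as G
∑⊆-∷ a as G = trans (∑-++ G (map (a ∷_) (sublists as)) _) (cong (_+ ∑⊆ as G) (∑-map G (a ∷_) (sublists as)))

∑⊆-map : ∀ (f : A → A′) as G → ∑⊆ (map f as) G ≡ ∑⊆ as (G ∘ map f)
∑⊆-map f []       G = refl
∑⊆-map f (a ∷ as) G = begin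
  ∑⊆ (f a ∷ map f as) G                              ≡⟨ ∑⊆-∷ (f a) (map f as) G ⟩
  ∑⊆ (map f as) (G ∘ (f a ∷_)) + ∑⊆ (map f as) G     ≡⟨ cong₂ _+_ (∑⊆-map f as (G ∘ (f a ∷_))) (∑⊆-map f as G) ⟩
  ∑⊆ as (G ∘ map f ∘ (a ∷_)) + ∑⊆ as (G ∘ map f)     ≡⟨ ∑⊆-∷ a as (G ∘ map f) ⟨
  ∑⊆ (a ∷ as) (G ∘ map f)                            ∎

∑⊆-++ : ∀ (as bs : List A) G → ∑⊆ (as ++ bs) G ≡ ∑⊆ as (λ z → ∑⊆ bs (λ z′ → G (z ++ z′)))
∑⊆-++ []       bs G = sym (ℚ.+-identityʳ _)
∑⊆-++ (a ∷ as) bs G = begin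
  ∑⊆ (a ∷ as ++ bs) G
    ≡⟨ ∑⊆-∷ a (as ++ bs) G ⟩
  ∑⊆ (as ++ bs) (G ∘ (a ∷_)) + ∑⊆ (as ++ bs) G
    ≡⟨ cong₂ _+_ (∑⊆-++ as bs (G ∘ (a ∷_))) (∑⊆-++ as bs G) ⟩
  ∑⊆ as (λ z → ∑⊆ bs (λ z′ → G (a ∷ z ++ z′))) + ∑⊆ as (λ z → ∑⊆ bs (λ z′ → G (z ++ z′)))
    ≡⟨ ∑⊆-∷ a as _ ⟨
  ∑⊆ (a ∷ as) (λ z → ∑⊆ bs (λ z′ → G (z ++ z′))) ∎

-- Deletes some bad elements, not necessarily all, and keeps the order. Sums over sublists survive
-- this when the summand vanishes on every sublist with a bad element.
data Prune {A : Set} (Bad : A → Set) : List A → List A → Set where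
  []   : Prune Bad [] []
  keep : ∀ {a as as′} → Prune Bad as as′ → Prune Bad (a ∷ as) (a ∷ as′)
  drop : ∀ {a as as′} → Bad a → Prune Bad as as′ → Prune Bad (a ∷ as) as′

∑⊆-prune : ∀ {Bad : A → Set} {as as′} → Prune Bad as as′ →
  ∀ {G} → (∀ {z} → Any Bad z → G z ≡ 0ℚ) → ∑⊆ as G ≡ ∑⊆ as′ G
∑⊆-prune [] G≡0 = refl
∑⊆-prune (keep {a} {as} {as′} pr) {G} G≡0 = trans (∑⊆-∷ a as G) (trans
  (cong₂ _+_ (∑⊆-prune pr (G≡0 ∘ there)) (∑⊆-prune pr G≡0))
  (sym (∑⊆-∷ a as′ G)))
∑⊆-prune (drop {a} {as} {as′} bad pr) {G} G≡0 = trans (∑⊆-∷ a as G) (trans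
  (cong₂ _+_ (∑-zeroᴬ (All.universal (λ z → G≡0 (here bad)) (sublists as))) (∑⊆-prune pr G≡0))
  (ℚ.+-identityˡ _))

prune-all : ∀ {Bad : A → Set} {as} → All Bad as → Prune Bad as []
prune-all []           = []
prune-all (bad ∷ bads) = drop bad (prune-all bads)

prune-none : ∀ {Bad : A → Set} as → Prune Bad as as
prune-none []       = []
prune-none (a ∷ as) = keep (prune-none as)

prune-map : ∀ {Bad : A → Set} {Bad′ : A′ → Set} (f : A → A′) → (∀ {a} → Bad a → Bad′ (f a)) →
  ∀ {as as′} → Prune Bad as as′ → Prune Bad′ (map f as) (map f as′)
prune-map f imp []            = []
prune-map f imp (keep pr)     = keep (prune-map f imp pr)
prune-map f imp (drop bad pr) = drop (imp bad) (prune-map f imp pr)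

prune-++ : ∀ {Bad : A → Set} {as as′ bs bs′} → Prune Bad as as′ → Prune Bad bs bs′ →
  Prune Bad (as ++ bs) (as′ ++ bs′)
prune-++ []            prs = prs
prune-++ (keep pr)     prs = keep (prune-++ pr prs)
prune-++ (drop bad pr) prs = drop bad (prune-++ pr prs)

nonemptySubsets : ∀ n → List (Subset n)
nonemptySubsets zero    = []
nonemptySubsets (suc n) = map (inside ∷_) (subsets n) ++ map (outside ∷_) (nonemptySubsets n)

prune-nonempty : ∀ n → Prune Empty (subsets n) (nonemptySubsets n)
prune-nonempty zero    = drop (λ ()) []
prune-nonempty (suc n) = prune-++
  (prune-none _)
  (prune-map (outside ∷_) (λ { e (Fin.suc i , there h) → e (i , h) }) (prune-nonempty n))

-- The subsets that are no block of a set partition below a slash product: every such block is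
-- nonempty and lies inside a block confined to one half.
Unsplit : ∀ n {m} → Subset (n ℕ.+ m) → Set
Unsplit n {m} B = Empty B ⊎ (∃[ i ] (i ↑ˡ m) ∈ˢ B) × (∃[ j ] (n ↑ʳ j) ∈ˢ B)

prune-left : ∀ n {m} → Prune (λ B → ∃[ j ] (n ↑ʳ j) ∈ˢ B) (subsets (n ℕ.+ m)) (map (embedˡ m) (subsets n))
prune-left zero {zero}  = keep []
prune-left zero {suc m} = prune-++
  (prune-all (All.map⁺ (All.universal (λ _ → Fin.zero , here) (subsets m))))
  (prune-map (outside ∷_) (λ (j , h) → Fin.suc j , there h) (prune-left zero))
prune-left (suc n) {m} = subst (Prune _ _)
  (trans (cong₂ _++_ (trans (sym (List.map-∘ (subsets n))) (List.map-∘ (subsets n)))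
                     (trans (sym (List.map-∘ (subsets n))) (List.map-∘ (subsets n))))
         (sym (List.map-++ (embedˡ m) (map (inside ∷_) (subsets n)) _)))
  (prune-++ (prune-map (inside ∷_) (λ (j , h) → j , there h) (prune-left n))
            (prune-map (outside ∷_) (λ (j , h) → j , there h) (prune-left n)))

-- `subsets` lists sets with the first element before sets without it, so the survivors from the
-- left half precede those from the right. The empty set is excluded on both sides because the two
-- embeddings would identify its copies.
prune-split : ∀ n {m} → Prune (Unsplit n) (subsets (n ℕ.+ m))
  (map (embedˡ m) (nonemptySubsets n) ++ map (embedʳ n) (nonemptySubsets m))
prune-split zero {m} = subst₂ (Prune _) (List.map-id (subsets m)) refl
  (prune-map (λ B → B) inj₁ (prune-nonempty m))
prune-split (suc n) {m} = subst (Prune _ _) rearrange (prune-++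
  -- A subset with the first element already meets the left half, so it is bad as soon as it meets
  -- the right one.
  (prune-map (inside ∷_) (λ (j , h) → inj₂ ((Fin.zero , here) , j , there h)) (prune-left n))
  (prune-map (outside ∷_) shift (prune-split n)))
  where
  shift : ∀ {B : Subset (n ℕ.+ m)} → Unsplit n B → Unsplit (suc n) (outside ∷ B)
  shift (inj₁ e)                    = inj₁ λ { (Fin.suc i , there h) → e (i , h) }
  shift (inj₂ ((i , h) , (j , h′))) = inj₂ ((Fin.suc i , there h) , j , there h′)
  ne = nonemptySubsets
  rearrange : map (inside ∷_) (map (embedˡ m) (subsets n)) ++
              map (outside ∷_) (map (embedˡ m) (ne n) ++ map (embedʳ n) (ne m)) ≡
              map (embedˡ m) (ne (suc n)) ++ map (embedʳ (suc n)) (ne m)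
  rearrange = begin
    map (inside ∷_) (map (embedˡ m) (subsets n)) ++ map (outside ∷_) (map (embedˡ m) (ne n) ++ map (embedʳ n) (ne m))
      ≡⟨ cong₂ _++_ (trans (sym (List.map-∘ (subsets n))) (List.map-∘ (subsets n)))
           (trans (List.map-++ (outside ∷_) (map (embedˡ m) (ne n)) _)
                  (cong₂ _++_ (trans (sym (List.map-∘ (ne n))) (List.map-∘ (ne n))) (sym (List.map-∘ (ne m))))) ⟩
    map (embedˡ m) (map (inside ∷_) (subsets n)) ++ map (embedˡ m) (map (outside ∷_) (ne n)) ++ map (embedʳ (suc n)) (ne m)
      ≡⟨ List.++-assoc (map (embedˡ m) (map (inside ∷_) (subsets n))) _ _ ⟨
    (map (embedˡ m) (map (inside ∷_) (subsets n)) ++ map (embedˡ m) (map (outside ∷_) (ne n)))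
      ++ map (embedʳ (suc n)) (ne m)
      ≡⟨ cong (_++ map (embedʳ (suc n)) (ne m)) (List.map-++ (embedˡ m) (map (inside ∷_) (subsets n)) _) ⟨
    map (embedˡ m) (ne (suc n)) ++ map (embedʳ (suc n)) (ne m) ∎

-- The Möbius expansion over bare lists of blocks

Below : SetPartition n → List (Subset n) → Set
Below π bs = IsSetPartition bs × All (λ B → Any (B ⊆_) (blocks π)) bs

below? : ∀ (π : SetPartition n) bs → Dec (Below π bs)
below? π bs = isSetPartition? bs ×-dec All.all? (λ B → Any.any? (B ⊆?_) (blocks π)) bs

inner : List (Subset n) → Subset n → ℕ
inner bs B = length (filter (_⊆? B) bs)

möbiusFactor : List (Subset n) → Subset n → ℤ
möbiusFactor bs B = (-1ℤ ℤ.^ (inner bs B ∸ 1)) ℤ.* ℤ.+ ((inner bs B ∸ 1) !)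

prodℤ : List ℤ → ℤ
prodℤ = foldr ℤ._*_ 1ℤ

-- Defined on bare lists because sums run over all sublists of `subsets n`, with `Below` as an
-- indicator. At `blocks σ` it is definitionally `u σ π / 1`.
möbius : SetPartition n → List (Subset n) → ℚ
möbius π bs = prodℤ (map (möbiusFactor bs) (blocks π)) / 1

opaque
  -- The effect of expanding x π in terms of the p σ and replacing each p σ by
  -- the value of h at the block sizes of σ.
  expand : SetPartition n → (List ℕ → ℚ) → ℚ
  expand {n} π h = ∑⊆ (subsets n) (λ bs → χ (below? π bs) * (möbius π bs * h (sizes bs)))

  expand-def : ∀ (π : SetPartition n) h →
    expand π h ≡ ∑⊆ (subsets n) (λ bs → χ (below? π bs) * (möbius π bs * h (sizes bs)))
  expand-def π h = refl

-- Sublists that are no set partition are skipped on the left and carry a zero indicator on the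
-- right.
∑-setPartitions : ∀ (π : SetPartition n) (F : List (Subset n) → ℚ) →
  ∑[ σ ∈ filter (_≼? π) (setPartitions n) ] F (blocks σ) ≡
  ∑⊆ (subsets n) (λ bs → χ (below? π bs) * F bs)
∑-setPartitions {n} π F = trans (∑-filter (_≼? π) (F ∘ blocks) (setPartitions n)) (go (sublists (subsets n)))
  where
  make : List (Subset n) → Maybe.Maybe (SetPartition n)
  make bs = Maybe.map (mkSetPartition bs) (dec⇒maybe (isSetPartition? bs))
  go : ∀ bss → ∑[ σ ∈ mapMaybe make bss ] χ (σ ≼? π) * F (blocks σ) ≡ ∑[ bs ∈ bss ] χ (below? π bs) * F bs
  go []         = refl
  go (bs ∷ bss) with isSetPartition? bs
  ... | yes is = cong₂ _+_
    (cong (_* F bs) (χ-cong (is ,_) proj₂ (mkSetPartition bs is ≼? π) (below? π bs)))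
    (go bss)
  ... | no ¬is = trans (go bss) (trans (sym (ℚ.+-identityˡ _))
    (cong (_+ _) (sym (χ-guard-0 (below? π bs) (λ (is , _) → contradiction is ¬is)))))

opaque
  unfolding expand

  ρ-x : ∀ (π : SetPartition n) e → coeff (ρ (x π)) e ≡ expand π (λ s → powerSum s e)
  ρ-x {n} π e = begin
    ∑[ w ∈ arrangements e ] ∑[ σ ∈ Σπ ] (u σ π / 1) * p σ w
      ≡⟨ ∑-swap _ (arrangements e) Σπ ⟩
    ∑[ σ ∈ Σπ ] ∑[ w ∈ arrangements e ] (u σ π / 1) * p σ w
      ≡⟨ ∑-cong (λ σ → trans (∑-*ˡ (u σ π / 1) (p σ) (arrangements e)) (cong (u σ π / 1 *_) (ρ-p σ e))) Σπ ⟩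
    ∑[ σ ∈ Σπ ] möbius π (blocks σ) * powerSum (sizes (blocks σ)) e
      ≡⟨ ∑-setPartitions π (λ bs → möbius π bs * powerSum (sizes bs) e) ⟩
    expand π (λ s → powerSum s e) ∎
    where
    Σπ : List (SetPartition n)
    Σπ = filter (_≼? π) (setPartitions n)

-- Factorisation of the expansion along slash products

_∣ᴸ_ : List (Subset n) → List (Subset m) → List (Subset (n ℕ.+ m))
_∣ᴸ_ {n} {m} bs cs = map (embedˡ m) bs ++ map (embedʳ n) cs

∈-embedˡ : ∀ {B : Subset n} {i} → (i ↑ˡ m) ∈ˢ embedˡ m B → i ∈ˢ B
∈-embedˡ {m = m} {B} {i} h with ∈-embedˡ⁻ {m = m} h
... | j , eq , j∈B = subst (_∈ˢ B) (Fin.↑ˡ-injective m j i eq) j∈B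

∈-embedʳ : ∀ {C : Subset m} {i} → (n ↑ʳ i) ∈ˢ embedʳ n C → i ∈ˢ C
∈-embedʳ {n = n} {C} {i} h with ∈-embedʳ⁻ {n} h
... | j , eq , j∈C = subst (_∈ˢ C) (Fin.↑ʳ-injective n j i eq) j∈C

↑ˡ≢↑ʳ : ∀ {i : Fin n} {j : Fin m} → i ↑ˡ m ≢ n ↑ʳ j
↑ˡ≢↑ʳ {n} {m} {i} {j} eq with trans (sym (Fin.splitAt-↑ˡ n i m)) (trans (cong (Fin.splitAt n) eq) (Fin.splitAt-↑ʳ n m j))
... | ()

↑ˡ∉embedʳ : ∀ {C : Subset m} {i : Fin n} → (i ↑ˡ m) ∉ˢ embedʳ n C
↑ˡ∉embedʳ {n = n} h with ∈-embedʳ⁻ {n} h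
... | j , eq , _ = ↑ˡ≢↑ʳ (sym eq)

↑ʳ∉embedˡ : ∀ {B : Subset n} {j : Fin m} → (n ↑ʳ j) ∉ˢ embedˡ m B
↑ʳ∉embedˡ {m = m} h with ∈-embedˡ⁻ {m = m} h
... | j , eq , _ = ↑ˡ≢↑ʳ eq

embedˡ-⊆⁺ : ∀ {B C : Subset n} → B ⊆ C → embedˡ m B ⊆ embedˡ m C
embedˡ-⊆⁺ {m = m} B⊆C h with ∈-embedˡ⁻ {m = m} h
... | j , refl , j∈B = ∈-++⁺ˡ ⊥ (B⊆C j∈B)

embedʳ-⊆⁺ : ∀ {B C : Subset m} → B ⊆ C → embedʳ n B ⊆ embedʳ n C
embedʳ-⊆⁺ {n = n} B⊆C h with ∈-embedʳ⁻ {n} h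
... | j , refl , j∈B = ∈-++⁺ʳ (⊥ {n}) (B⊆C j∈B)

embedˡ-⊆⁻ : ∀ {B C : Subset n} → embedˡ m B ⊆ embedˡ m C → B ⊆ C
embedˡ-⊆⁻ {m = m} sub i∈B = ∈-embedˡ {m = m} (sub (∈-++⁺ˡ ⊥ i∈B))

embedʳ-⊆⁻ : ∀ {B C : Subset m} → embedʳ n B ⊆ embedʳ n C → B ⊆ C
embedʳ-⊆⁻ {n = n} sub i∈B = ∈-embedʳ {n = n} (sub (∈-++⁺ʳ (⊥ {n}) i∈B))

embedˡ⊈embedʳ : ∀ {B : Subset n} {C : Subset m} → Nonempty B → ¬ (embedˡ m B ⊆ embedʳ n C)
embedˡ⊈embedʳ {n = n} (i , i∈B) sub = ↑ˡ∉embedʳ {n = n} (sub (∈-++⁺ˡ ⊥ i∈B))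

embedʳ⊈embedˡ : ∀ {B : Subset n} {C : Subset m} → Nonempty C → ¬ (embedʳ n C ⊆ embedˡ m B)
embedʳ⊈embedˡ {n = n} {m = m} (i , i∈C) sub = ↑ʳ∉embedˡ {m = m} (sub (∈-++⁺ʳ (⊥ {n}) i∈C))

nonempty-embedˡ : ∀ {B : Subset n} → Nonempty (embedˡ m B) → Nonempty B
nonempty-embedˡ {m = m} (_ , h) with ∈-embedˡ⁻ {m = m} h
... | j , _ , j∈B = j , j∈B

nonempty-embedʳ : ∀ {C : Subset m} → Nonempty (embedʳ n C) → Nonempty C
nonempty-embedʳ {n = n} (_ , h) with ∈-embedʳ⁻ {n} h
... | j , _ , j∈C = j , j∈C

any-⊆-embedˡ⁺ : ∀ {B : Subset n} {Cs} → Any (B ⊆_) Cs → Any (embedˡ m B ⊆_) (map (embedˡ m) Cs)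
any-⊆-embedˡ⁺ (here {C} sub) = here (embedˡ-⊆⁺ {C = C} sub)
any-⊆-embedˡ⁺ (there h)  = there (any-⊆-embedˡ⁺ h)

any-⊆-embedʳ⁺ : ∀ {B : Subset m} {Cs} → Any (B ⊆_) Cs → Any (embedʳ n B ⊆_) (map (embedʳ n) Cs)
any-⊆-embedʳ⁺ (here {C} sub) = here (embedʳ-⊆⁺ {C = C} sub)
any-⊆-embedʳ⁺ (there h)  = there (any-⊆-embedʳ⁺ h)

any-⊆-embedˡ⁻ : ∀ {B : Subset n} Cs → Any (embedˡ m B ⊆_) (map (embedˡ m) Cs) → Any (B ⊆_) Cs
any-⊆-embedˡ⁻ {m = m} (C ∷ _) (here sub) = here (embedˡ-⊆⁻ {m = m} {C = C} sub)
any-⊆-embedˡ⁻ (_ ∷ Cs) (there h) = there (any-⊆-embedˡ⁻ Cs h)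

any-⊆-embedʳ⁻ : ∀ {B : Subset m} Cs → Any (embedʳ n B ⊆_) (map (embedʳ n) Cs) → Any (B ⊆_) Cs
any-⊆-embedʳ⁻ {n = n} (C ∷ _) (here sub) = here (embedʳ-⊆⁻ {n = n} {C = C} sub)
any-⊆-embedʳ⁻ (_ ∷ Cs) (there h) = there (any-⊆-embedʳ⁻ Cs h)

below-∣⁺ : ∀ {π : SetPartition n} {σ : SetPartition m} {bs cs} → Below π bs → Below σ cs → Below (π ∣ˢ σ) (bs ∣ᴸ cs)
below-∣⁺ {n} {m} {π} {σ} {bs} {cs} (isπ , below-π) (isσ , below-σ) =
  isSetPartition (mkSetPartition bs isπ ∣ˢ mkSetPartition cs isσ) ,
  All.++⁺ (All.map⁺ (All.map (λ b → Any.++⁺ˡ (any-⊆-embedˡ⁺ b)) below-π))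
          (All.map⁺ (All.map (λ c → Any.++⁺ʳ (map (embedˡ m) (blocks π)) (any-⊆-embedʳ⁺ c)) below-σ))

allPairs-++⁻ˡ : ∀ {R : A → A → Set} as {bs} → AllPairs R (as ++ bs) → AllPairs R as
allPairs-++⁻ˡ []       _        = []
allPairs-++⁻ˡ (a ∷ as) (r ∷ rs) = All.++⁻ˡ as r ∷ allPairs-++⁻ˡ as rs

allPairs-++⁻ʳ : ∀ {R : A → A → Set} as {bs} → AllPairs R (as ++ bs) → AllPairs R bs
allPairs-++⁻ʳ []       rs       = rs
allPairs-++⁻ʳ (a ∷ as) (r ∷ rs) = allPairs-++⁻ʳ as rs

-- Nonemptiness decides the sides: an embedded nonempty block has an element in its own half, so the
-- block above it lies in the same half. Covering descends since no element of one half is in a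
-- block embedded from the other.
below-∣⁻ : ∀ {π : SetPartition n} {σ : SetPartition m} {bs cs} → Below (π ∣ˢ σ) (bs ∣ᴸ cs) → Below π bs × Below σ cs
below-∣⁻ {n} {m} {π} {σ} {bs} {cs} (is , below) =
  ( record
    { nonempty = nonemptyˡ
    ; disjoint = AllPairs.map (λ e (i , h) → let hB , hC = x∈p∩q⁻ _ _ h in
          e (i ↑ˡ m , x∈p∩q⁺ (∈-++⁺ˡ ⊥ hB , ∈-++⁺ˡ ⊥ hC)))
        (AllPairs.map⁻ (allPairs-++⁻ˡ (map (embedˡ m) bs) is.disjoint))
    ; covering = λ i → coverˡ i (Any.++⁻ (map (embedˡ m) bs) (is.covering (i ↑ˡ m)))
    }
  , All.map (λ {B} (ne , b) → lowerˡ ne (Any.++⁻ (map (embedˡ m) (blocks π)) b))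
      (All.zip (nonemptyˡ , All.map⁻ (All.++⁻ˡ (map (embedˡ m) bs) below)))
  ) ,
  ( record
    { nonempty = nonemptyʳ
    ; disjoint = AllPairs.map (λ e (i , h) → let hB , hC = x∈p∩q⁻ _ _ h in
          e (n ↑ʳ i , x∈p∩q⁺ (∈-++⁺ʳ (⊥ {n}) hB , ∈-++⁺ʳ (⊥ {n}) hC)))
        (AllPairs.map⁻ (allPairs-++⁻ʳ (map (embedˡ m) bs) is.disjoint))
    ; covering = λ i → coverʳ i (Any.++⁻ (map (embedˡ m) bs) (is.covering (n ↑ʳ i)))
    }
  , All.map (λ {B} (ne , b) → lowerʳ ne (Any.++⁻ (map (embedˡ m) (blocks π)) b))
      (All.zip (nonemptyʳ , All.map⁻ (All.++⁻ʳ (map (embedˡ m) bs) below)))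
  )
  where
  module is = IsSetPartition is
  nonemptyˡ : All Nonempty bs
  nonemptyˡ = All.map (nonempty-embedˡ {m = m}) (All.map⁻ (All.++⁻ˡ (map (embedˡ m) bs) is.nonempty))
  nonemptyʳ : All Nonempty cs
  nonemptyʳ = All.map (nonempty-embedʳ {n = n}) (All.map⁻ (All.++⁻ʳ (map (embedˡ m) bs) is.nonempty))
  coverˡ : ∀ i → Any (i ↑ˡ m ∈ˢ_) (map (embedˡ m) bs) ⊎ Any (i ↑ˡ m ∈ˢ_) (map (embedʳ n) cs) → Any (i ∈ˢ_) bs
  coverˡ i (inj₁ h) = Any.map (∈-embedˡ {m = m}) (Any.map⁻ h)
  coverˡ i (inj₂ h) = let _ , h′ = Any.satisfied (Any.map⁻ h) in contradiction h′ (↑ˡ∉embedʳ {n = n})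
  coverʳ : ∀ i → Any (n ↑ʳ i ∈ˢ_) (map (embedˡ m) bs) ⊎ Any (n ↑ʳ i ∈ˢ_) (map (embedʳ n) cs) → Any (i ∈ˢ_) cs
  coverʳ i (inj₁ h) = let _ , h′ = Any.satisfied (Any.map⁻ h) in contradiction h′ (↑ʳ∉embedˡ {m = m})
  coverʳ i (inj₂ h) = Any.map (∈-embedʳ {n = n}) (Any.map⁻ h)
  lowerˡ : ∀ {B} → Nonempty B →
    Any (embedˡ m B ⊆_) (map (embedˡ m) (blocks π)) ⊎ Any (embedˡ m B ⊆_) (map (embedʳ n) (blocks σ)) →
    Any (B ⊆_) (blocks π)
  lowerˡ ne (inj₁ h) = any-⊆-embedˡ⁻ (blocks π) h
  lowerˡ ne (inj₂ h) = let _ , sub = Any.satisfied (Any.map⁻ h) in contradiction (λ {_} → sub) (embedˡ⊈embedʳ ne)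
  lowerʳ : ∀ {C} → Nonempty C →
    Any (embedʳ n C ⊆_) (map (embedˡ m) (blocks π)) ⊎ Any (embedʳ n C ⊆_) (map (embedʳ n) (blocks σ)) →
    Any (C ⊆_) (blocks σ)
  lowerʳ ne (inj₁ h) = let _ , sub = Any.satisfied (Any.map⁻ h) in contradiction (λ {_} → sub) (embedʳ⊈embedˡ ne)
  lowerʳ ne (inj₂ h) = any-⊆-embedʳ⁻ (blocks σ) h

χ-below-∣ : ∀ (π : SetPartition n) (σ : SetPartition m) bs cs →
  χ (below? (π ∣ˢ σ) (bs ∣ᴸ cs)) ≡ χ (below? π bs) * χ (below? σ cs)
χ-below-∣ π σ bs cs = trans
  (χ-cong (below-∣⁻ {π = π} {σ} {bs} {cs}) (λ (b , c) → below-∣⁺ {π = π} {σ} b c)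
    (below? (π ∣ˢ σ) (bs ∣ᴸ cs)) (below? π bs ×-dec below? σ cs))
  (χ-× (below? π bs) (below? σ cs))

length-filter-map : ∀ {P : Pred A′ 0ℓ} {Q : Pred A 0ℓ} (P? : Decidable P) (Q? : Decidable Q) (f : A → A′) →
  (∀ {a} → P (f a) → Q a) → (∀ {a} → Q a → P (f a)) →
  ∀ as → length (filter P? (map f as)) ≡ length (filter Q? as)
length-filter-map P? Q? f to from []       = refl
length-filter-map P? Q? f to from (a ∷ as) with Q? a
... | yes q = trans (cong length (List.filter-accept P? (from q))) (cong suc (length-filter-map P? Q? f to from as))
... | no ¬q = trans (cong length (List.filter-reject P? (¬q ∘ to))) (length-filter-map P? Q? f to from as)

-- Nonempty blocks from the right half never lie in a block of the left half, so they do not affect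
-- the count.
inner-∣ˡ : ∀ (bs : List (Subset n)) {cs : List (Subset m)} → All Nonempty cs → ∀ B →
  inner (bs ∣ᴸ cs) (embedˡ m B) ≡ inner bs B
inner-∣ˡ {n} {m} bs {cs} ne B = begin
  length (filter P? (map (embedˡ m) bs ++ map (embedʳ n) cs))
    ≡⟨ cong length (trans (List.filter-++ P? (map (embedˡ m) bs) _)
         (cong (filter P? (map (embedˡ m) bs) ++_)
           (List.filter-none P? (All.map⁺ (All.map (λ c → embedʳ⊈embedˡ {n = n} c) ne))))) ⟩
  length (filter P? (map (embedˡ m) bs) ++ [])
    ≡⟨ cong length (List.++-identityʳ (filter P? (map (embedˡ m) bs))) ⟩
  length (filter P? (map (embedˡ m) bs))
    ≡⟨ length-filter-map P? (_⊆? B) (embedˡ m) (λ s {_} → embedˡ-⊆⁻ {m = m} s) (λ s {_} → embedˡ-⊆⁺ {m = m} s) bs ⟩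
  inner bs B ∎
  where P? = _⊆? embedˡ m B

inner-∣ʳ : ∀ {bs : List (Subset n)} (cs : List (Subset m)) → All Nonempty bs → ∀ C →
  inner (bs ∣ᴸ cs) (embedʳ n C) ≡ inner cs C
inner-∣ʳ {n} {m} {bs} cs ne C = begin
  length (filter P? (map (embedˡ m) bs ++ map (embedʳ n) cs))
    ≡⟨ cong length (trans (List.filter-++ P? (map (embedˡ m) bs) _)
         (cong (_++ filter P? (map (embedʳ n) cs)) (List.filter-none P? (All.map⁺ (All.map (λ b → embedˡ⊈embedʳ b) ne))))) ⟩
  length (filter P? (map (embedʳ n) cs))
    ≡⟨ length-filter-map P? (_⊆? C) (embedʳ n) (λ s {_} → embedʳ-⊆⁻ {n = n} s) (λ s {_} → embedʳ-⊆⁺ {n = n} s) cs ⟩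
  inner cs C ∎
  where P? = _⊆? embedʳ n C

prodℤ-++ : ∀ is js → prodℤ (is ++ js) ≡ prodℤ is ℤ.* prodℤ js
prodℤ-++ []       js = sym (ℤ.*-identityˡ (prodℤ js))
prodℤ-++ (i ∷ is) js = trans (cong (i ℤ.*_) (prodℤ-++ is js)) (sym (ℤ.*-assoc i (prodℤ is) (prodℤ js)))

-- `_/_` normalises its result, so the two sides are compared as unnormalised rationals.
/1-homo-* : ∀ i j → (i ℤ.* j) / 1 ≡ (i / 1) * (j / 1)
/1-homo-* i j = ℚ.toℚᵘ-injective (ℚᵘ.≃-trans (ℚ.toℚᵘ-fromℚᵘ (ℚᵘ.mkℚᵘ (i ℤ.* j) 0)) (ℚᵘ.≃-sym (ℚᵘ.≃-trans
  (ℚ.toℚᵘ-homo-* (i / 1) (j / 1))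
  (ℚᵘ.*-cong (ℚ.toℚᵘ-fromℚᵘ (ℚᵘ.mkℚᵘ i 0)) (ℚ.toℚᵘ-fromℚᵘ (ℚᵘ.mkℚᵘ j 0))))))

möbius-∣ : ∀ (π : SetPartition n) (σ : SetPartition m) {bs cs} → All Nonempty bs → All Nonempty cs →
  möbius (π ∣ˢ σ) (bs ∣ᴸ cs) ≡ möbius π bs * möbius σ cs
möbius-∣ {n} {m} π σ {bs} {cs} ne ne′ = trans (cong (_/ 1) product)
  (/1-homo-* (prodℤ (map (möbiusFactor bs) (blocks π))) (prodℤ (map (möbiusFactor cs) (blocks σ))))
  where
  f = möbiusFactor (bs ∣ᴸ cs)
  signed : ℕ → ℤ
  signed k = (-1ℤ ℤ.^ (k ∸ 1)) ℤ.* ℤ.+ ((k ∸ 1) !)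
  product : prodℤ (map f (blocks (π ∣ˢ σ))) ≡
    prodℤ (map (möbiusFactor bs) (blocks π)) ℤ.* prodℤ (map (möbiusFactor cs) (blocks σ))
  product = trans
    (cong prodℤ (trans (List.map-++ f (map (embedˡ m) (blocks π)) _) (cong₂ _++_
      (trans (sym (List.map-∘ (blocks π))) (List.map-cong (cong signed ∘ inner-∣ˡ bs ne′) (blocks π)))
      (trans (sym (List.map-∘ (blocks σ))) (List.map-cong (cong signed ∘ inner-∣ʳ cs ne) (blocks σ))))))
    (prodℤ-++ (map (möbiusFactor bs) (blocks π)) _)

∣embedˡ∣ : ∀ (B : Subset n) → ∣ embedˡ m B ∣ ≡ ∣ B ∣
∣embedˡ∣ {m = m} []      = ∣⊥∣≡0 m
∣embedˡ∣ (inside ∷ B)    = cong suc (∣embedˡ∣ B)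
∣embedˡ∣ (outside ∷ B)   = ∣embedˡ∣ B

∣embedʳ∣ : ∀ n (C : Subset m) → ∣ embedʳ n C ∣ ≡ ∣ C ∣
∣embedʳ∣ zero    C = refl
∣embedʳ∣ (suc n) C = ∣embedʳ∣ n C

sizes-∣ : ∀ (bs : List (Subset n)) (cs : List (Subset m)) → sizes (bs ∣ᴸ cs) ≡ sizes bs ++ sizes cs
sizes-∣ {n} {m} bs cs = trans (List.map-++ ∣_∣ (map (embedˡ m) bs) _) (cong₂ _++_
  (trans (sym (List.map-∘ bs)) (List.map-cong ∣embedˡ∣ bs))
  (trans (sym (List.map-∘ cs)) (List.map-cong (∣embedʳ∣ n) cs)))

below⇒nonempty : ∀ {π : SetPartition n} {bs} → Below π bs → All Nonempty bs
below⇒nonempty (is , _) = IsSetPartition.nonempty is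

opaque
  unfolding expand

  expand-nonempty : ∀ (π : SetPartition n) h →
    expand π h ≡ ∑⊆ (nonemptySubsets n) (λ bs → χ (below? π bs) * (möbius π bs * h (sizes bs)))
  expand-nonempty {n} π h = ∑⊆-prune (prune-nonempty n) λ {bs} e → χ-guard-0 (below? π bs)
    λ b → let ne , e′ = All.lookupAny (below⇒nonempty {π = π} b) e in contradiction ne e′

-- `prune-split` makes the sum run over pairs of sublists; on a pair the indicators and Möbius
-- values multiply while the sizes concatenate. As `h` is arbitrary, the identity iterates along
-- `⟦_⟧`.
expand-∣ : ∀ (π : SetPartition n) (σ : SetPartition m) h →
  expand (π ∣ˢ σ) h ≡ expand π (λ s → expand σ (λ t → h (s ++ t)))
expand-∣ {n} {m} π σ h = begin
  expand (π ∣ˢ σ) h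
    ≡⟨ expand-def (π ∣ˢ σ) h ⟩
  ∑⊆ (subsets (n ℕ.+ m)) G
    ≡⟨ ∑⊆-prune (prune-split n) (λ {z} b → χ-guard-0 (below? (π ∣ˢ σ) z) (unsplit b)) ⟩
  ∑⊆ (map (embedˡ m) (ne n) ++ map (embedʳ n) (ne m)) G
    ≡⟨ ∑⊆-++ (map (embedˡ m) (ne n)) _ G ⟩
  ∑⊆ (map (embedˡ m) (ne n)) (λ z → ∑⊆ (map (embedʳ n) (ne m)) (λ z′ → G (z ++ z′)))
    ≡⟨ ∑⊆-map (embedˡ m) (ne n) _ ⟩
  ∑⊆ (ne n) (λ bs → ∑⊆ (map (embedʳ n) (ne m)) (λ z′ → G (map (embedˡ m) bs ++ z′)))
    ≡⟨ ∑-cong (λ bs → trans (∑⊆-map (embedʳ n) (ne m) _) (inside-sum bs)) (sublists (ne n)) ⟩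
  ∑⊆ (ne n) (λ bs → χ (below? π bs) * (möbius π bs * expand σ (λ t → h (sizes bs ++ t))))
    ≡⟨ expand-nonempty π (λ s → expand σ (λ t → h (s ++ t))) ⟨
  expand π (λ s → expand σ (λ t → h (s ++ t))) ∎
  where
  ne = nonemptySubsets
  G : List (Subset (n ℕ.+ m)) → ℚ
  G z = χ (below? (π ∣ˢ σ) z) * (möbius (π ∣ˢ σ) z * h (sizes z))
  unsplit : ∀ {z} {q : ℚ} → Any (Unsplit n) z → Below (π ∣ˢ σ) z → q ≡ 0ℚ
  unsplit a (is , below) with All.lookupAny (All.zip (IsSetPartition.nonempty is , below)) a
  ... | (B≢∅ , _) , inj₁ B≡∅ = contradiction B≢∅ B≡∅
  ... | (_ , B⊆) , inj₂ ((i , hi) , (j , hj)) with Any.++⁻ (map (embedˡ m) (blocks π)) B⊆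
  ...   | inj₁ l = let _ , sub = Any.satisfied (Any.map⁻ l) in contradiction (sub hj) (↑ʳ∉embedˡ {m = m})
  ...   | inj₂ r = let _ , sub = Any.satisfied (Any.map⁻ r) in contradiction (sub hi) (↑ˡ∉embedʳ {n = n})
  term : ∀ bs cs → G (bs ∣ᴸ cs) ≡
    (χ (below? π bs) * möbius π bs) * (χ (below? σ cs) * (möbius σ cs * h (sizes bs ++ sizes cs)))
  term bs cs = begin
    χ (below? (π ∣ˢ σ) (bs ∣ᴸ cs)) * (möbius (π ∣ˢ σ) (bs ∣ᴸ cs) * h (sizes (bs ∣ᴸ cs)))
      -- Multiplicativity of the Möbius function needs nonempty blocks on both sides; the guard
      -- provides them.
      ≡⟨ χ-guard (below? (π ∣ˢ σ) (bs ∣ᴸ cs)) (λ b → let b₁ , b₂ = below-∣⁻ {π = π} {σ} {bs} {cs} b in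
           cong₂ _*_ (möbius-∣ π σ (below⇒nonempty {π = π} b₁) (below⇒nonempty {π = σ} b₂)) (cong h (sizes-∣ bs cs))) ⟩
    χ (below? (π ∣ˢ σ) (bs ∣ᴸ cs)) * ((möbius π bs * möbius σ cs) * h (sizes bs ++ sizes cs))
      ≡⟨ cong (_* ((möbius π bs * möbius σ cs) * h (sizes bs ++ sizes cs))) (χ-below-∣ π σ bs cs) ⟩
    (χ (below? π bs) * χ (below? σ cs)) * ((möbius π bs * möbius σ cs) * h (sizes bs ++ sizes cs))
      ≡⟨ regroup (χ (below? π bs)) (χ (below? σ cs)) (möbius π bs) (möbius σ cs) (h (sizes bs ++ sizes cs)) ⟩
    (χ (below? π bs) * möbius π bs) * (χ (below? σ cs) * (möbius σ cs * h (sizes bs ++ sizes cs))) ∎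
    where
    regroup : ∀ a b c d e → (a * b) * ((c * d) * e) ≡ (a * c) * (b * (d * e))
    regroup = solve 5 (λ a b c d e → (a :* b) :* ((c :* d) :* e) := (a :* c) :* (b :* (d :* e))) refl
      where open +-*-Solver
  inside-sum : ∀ bs → ∑⊆ (ne m) (λ cs → G (bs ∣ᴸ cs)) ≡
    χ (below? π bs) * (möbius π bs * expand σ (λ t → h (sizes bs ++ t)))
  inside-sum bs = begin
    ∑⊆ (ne m) (λ cs → G (bs ∣ᴸ cs))
      ≡⟨ trans (∑-cong (term bs) (sublists (ne m))) (∑-*ˡ (χ (below? π bs) * möbius π bs) _ (sublists (ne m))) ⟩
    (χ (below? π bs) * möbius π bs) * ∑⊆ (ne m) (λ cs → χ (below? σ cs) * (möbius σ cs * h (sizes bs ++ sizes cs)))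
      ≡⟨ cong ((χ (below? π bs) * möbius π bs) *_) (expand-nonempty σ (λ t → h (sizes bs ++ t))) ⟨
    (χ (below? π bs) * möbius π bs) * expand σ (λ t → h (sizes bs ++ t))
      ≡⟨ ℚ.*-assoc (χ (below? π bs)) (möbius π bs) _ ⟩
    χ (below? π bs) * (möbius π bs * expand σ (λ t → h (sizes bs ++ t))) ∎

-- Multiplicativity

nonempty⇒0<∣∣ : ∀ {B : Subset n} → Nonempty B → 0 < ∣ B ∣
nonempty⇒0<∣∣ (_ , i∈B) = ℕ.≤-<-trans ℕ.z≤n (x∈p⇒∣p-x∣<∣p∣ i∈B)

opaque
  unfolding expand

  expand-cong : ∀ (π : SetPartition n) {h h′} → (∀ s → All (0 <_) s → sum s ≡ n → h s ≡ h′ s) →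
    expand π h ≡ expand π h′
  expand-cong {n} π eq = ∑-cong
    (λ bs → χ-guard (below? π bs) λ (is , _) → cong (möbius π bs *_) (eq (sizes bs)
      (All.map⁺ (All.map nonempty⇒0<∣∣ (IsSetPartition.nonempty is)))
      (sum-sizes (exact (mkSetPartition bs is)))))
    (sublists (subsets n))

  expand-∑ : ∀ (π : SetPartition n) (f : A′ → List ℕ → ℚ) as →
    expand π (λ s → ∑[ a ∈ as ] f a s) ≡ ∑[ a ∈ as ] expand π (f a)
  expand-∑ {n} π f as = trans
    (∑-cong (λ bs → trans
        (cong (χ (below? π bs) *_) (sym (∑-*ˡ (möbius π bs) (λ a → f a (sizes bs)) as)))
        (sym (∑-*ˡ (χ (below? π bs)) _ as)))
      (sublists (subsets n)))
    (∑-swap _ (sublists (subsets n)) as)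

  expand-*ˡ : ∀ (π : SetPartition n) r h → expand π (λ s → r * h s) ≡ r * expand π h
  expand-*ˡ {n} π r h = trans
    (∑-cong (λ bs → trans (cong (χ (below? π bs) *_) (*-exchange (möbius π bs) r (h (sizes bs))))
                          (*-exchange (χ (below? π bs)) r (möbius π bs * h (sizes bs))))
      (sublists (subsets n)))
    (∑-*ˡ r _ (sublists (subsets n)))

  expand-swap : ∀ (π : SetPartition n) (σ : SetPartition m) (h : List ℕ → List ℕ → ℚ) →
    expand π (λ s → expand σ (h s)) ≡ expand σ (λ t → expand π (λ s → h s t))
  expand-swap {n} {m} π σ h = begin
    expand π (λ s → expand σ (h s))
      ≡⟨ expand-∑ π (λ cs s → χ (below? σ cs) * (möbius σ cs * h s (sizes cs))) (sublists (subsets m)) ⟩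
    ∑⊆ (subsets m) (λ cs → expand π (λ s → χ (below? σ cs) * (möbius σ cs * h s (sizes cs))))
      ≡⟨ ∑-cong (λ cs → trans (expand-*ˡ π (χ (below? σ cs)) (λ s → möbius σ cs * h s (sizes cs)))
           (cong (χ (below? σ cs) *_) (expand-*ˡ π (möbius σ cs) (λ s → h s (sizes cs))))) (sublists (subsets m)) ⟩
    expand σ (λ t → expand π (λ s → h s t)) ∎

  expand-[] : ∀ h → expand ⟦ [] ⟧ h ≡ h []
  expand-[] h = begin
    -- `subsets 0` has two sublists: the one with the empty block is excluded, and the empty list is
    -- the only set partition of the empty set.
    0ℚ * (möbius ⟦ [] ⟧ ([] ∷ []) * h (0 ∷ [])) + (1ℚ * (1ℚ * h []) + 0ℚ)
      ≡⟨ cong₂ _+_ (ℚ.*-zeroˡ (möbius ⟦ [] ⟧ ([] ∷ []) * h (0 ∷ [])))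
           (trans (ℚ.+-identityʳ (1ℚ * (1ℚ * h []))) (trans (ℚ.*-identityˡ (1ℚ * h [])) (ℚ.*-identityˡ (h [])))) ⟩
    0ℚ + h []
      ≡⟨ ℚ.+-identityˡ (h []) ⟩
    h [] ∎

expand-ext : ∀ (π : SetPartition n) {h h′} → (∀ s → h s ≡ h′ s) → expand π h ≡ expand π h′
expand-ext π eq = expand-cong π (λ s _ _ → eq s)

expand-0 : ∀ (π : SetPartition n) → expand π (λ _ → 0ℚ) ≡ 0ℚ
expand-0 π = trans (expand-*ˡ π 0ℚ (λ _ → 0ℚ)) (ℚ.*-zeroˡ (expand π (λ _ → 0ℚ)))

expand-*ʳ : ∀ (π : SetPartition n) r h → expand π (λ s → h s * r) ≡ expand π h * r
expand-*ʳ π r h = trans (expand-ext π (λ s → ℚ.*-comm (h s) r))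
  (trans (expand-*ˡ π r h) (ℚ.*-comm r _))

expand-++ : ∀ l l′ h → expand ⟦ l ++ l′ ⟧ h ≡ expand ⟦ l ⟧ (λ s → expand ⟦ l′ ⟧ (λ t → h (s ++ t)))
expand-++ []      l′ h = sym (expand-[] _)
expand-++ (a ∷ l) l′ h = begin
  expand ⟦ a ∷ l ++ l′ ⟧ h
    ≡⟨ expand-∣ ⟦ a ⟧₁ ⟦ l ++ l′ ⟧ h ⟩
  expand ⟦ a ⟧₁ (λ s → expand ⟦ l ++ l′ ⟧ (λ t → h (s ++ t)))
    ≡⟨ expand-ext ⟦ a ⟧₁ (λ s → trans (expand-++ l l′ (λ t → h (s ++ t)))
         (expand-ext ⟦ l ⟧ (λ t → expand-ext ⟦ l′ ⟧ (λ r → cong h (sym (List.++-assoc s t r)))))) ⟩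
  expand ⟦ a ⟧₁ (λ s → expand ⟦ l ⟧ (λ t → expand ⟦ l′ ⟧ (λ r → h ((s ++ t) ++ r))))
    ≡⟨ expand-∣ ⟦ a ⟧₁ ⟦ l ⟧ _ ⟨
  expand ⟦ a ∷ l ⟧ (λ s → expand ⟦ l′ ⟧ (λ t → h (s ++ t))) ∎

-- Adjacent single-block factors are exchanged by exchanging two finite sums; the sizes then arrive
-- in another order, which `h` ignores.
expand-↭ : ∀ {l l′} → l ↭ l′ → ∀ {h} → (∀ {s t} → s ↭ t → h s ≡ h t) → expand ⟦ l ⟧ h ≡ expand ⟦ l′ ⟧ h
expand-↭ Perm.refl inv = refl
expand-↭ (Perm.prep {l} {l′} a p) {h} inv = begin
  expand ⟦ a ∷ l ⟧ h
    ≡⟨ expand-∣ ⟦ a ⟧₁ ⟦ l ⟧ h ⟩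
  expand ⟦ a ⟧₁ (λ s → expand ⟦ l ⟧ (λ t → h (s ++ t)))
    ≡⟨ expand-ext ⟦ a ⟧₁ (λ s → expand-↭ p (inv ∘ Perm.++⁺ˡ s)) ⟩
  expand ⟦ a ⟧₁ (λ s → expand ⟦ l′ ⟧ (λ t → h (s ++ t)))
    ≡⟨ expand-∣ ⟦ a ⟧₁ ⟦ l′ ⟧ h ⟨
  expand ⟦ a ∷ l′ ⟧ h ∎
expand-↭ (Perm.swap {l} {l′} a b p) {h} inv = begin
  expand ⟦ a ∷ b ∷ l ⟧ h
    ≡⟨ twice a b l ⟩
  expand ⟦ a ⟧₁ (λ s → expand ⟦ b ⟧₁ (λ t → expand ⟦ l ⟧ (λ r → h (s ++ t ++ r))))
    ≡⟨ expand-swap ⟦ a ⟧₁ ⟦ b ⟧₁ _ ⟩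
  expand ⟦ b ⟧₁ (λ t → expand ⟦ a ⟧₁ (λ s → expand ⟦ l ⟧ (λ r → h (s ++ t ++ r))))
    ≡⟨ expand-ext ⟦ b ⟧₁ (λ t → expand-ext ⟦ a ⟧₁ (λ s →
         trans (expand-↭ p (inv ∘ Perm.++⁺ˡ s ∘ Perm.++⁺ˡ t))
               (expand-ext ⟦ l′ ⟧ (λ _ → inv (Perm.shifts s t))))) ⟩
  expand ⟦ b ⟧₁ (λ t → expand ⟦ a ⟧₁ (λ s → expand ⟦ l′ ⟧ (λ r → h (t ++ s ++ r))))
    ≡⟨ twice b a l′ ⟨
  expand ⟦ b ∷ a ∷ l′ ⟧ h ∎
  where
  twice : ∀ a b l → expand ⟦ a ∷ b ∷ l ⟧ h ≡
    expand ⟦ a ⟧₁ (λ s → expand ⟦ b ⟧₁ (λ t → expand ⟦ l ⟧ (λ r → h (s ++ t ++ r))))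
  twice a b l = trans (expand-∣ ⟦ a ⟧₁ ⟦ b ∷ l ⟧ h) (expand-ext ⟦ a ⟧₁ (λ s → expand-∣ ⟦ b ⟧₁ ⟦ l ⟧ (λ t → h (s ++ t))))
expand-↭ (Perm.trans p q) inv = trans (expand-↭ p inv) (expand-↭ q inv)

ρ-x-* : ∀ l l′ e → coeff (ρ (x ⟦ l ⟧) *ˢ ρ (x ⟦ l′ ⟧)) e ≡ coeff (ρ (x ⟦ l ++ l′ ⟧)) e
ρ-x-* l l′ e = begin
  ∑[ (d , d′) ∈ factorisations e ] coeff (ρ (x ⟦ l ⟧)) d * coeff (ρ (x ⟦ l′ ⟧)) d′
    ≡⟨ ∑-cong (λ (d , d′) → begin
         coeff (ρ (x ⟦ l ⟧)) d * coeff (ρ (x ⟦ l′ ⟧)) d′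
           ≡⟨ cong₂ _*_ (ρ-x ⟦ l ⟧ d) (ρ-x ⟦ l′ ⟧ d′) ⟩
         expand ⟦ l ⟧ (λ s → powerSum s d) * expand ⟦ l′ ⟧ (λ t → powerSum t d′)
           ≡⟨ expand-*ʳ ⟦ l ⟧ (expand ⟦ l′ ⟧ (λ t → powerSum t d′)) (λ s → powerSum s d) ⟨
         expand ⟦ l ⟧ (λ s → powerSum s d * expand ⟦ l′ ⟧ (λ t → powerSum t d′))
           ≡⟨ expand-ext ⟦ l ⟧ (λ s → expand-*ˡ ⟦ l′ ⟧ (powerSum s d) (λ t → powerSum t d′)) ⟨
         expand ⟦ l ⟧ (λ s → expand ⟦ l′ ⟧ (λ t → powerSum s d * powerSum t d′)) ∎)
       (factorisations e) ⟩
  ∑[ (d , d′) ∈ factorisations e ] expand ⟦ l ⟧ (λ s → expand ⟦ l′ ⟧ (λ t → powerSum s d * powerSum t d′))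
    ≡⟨ trans
         (expand-ext ⟦ l ⟧ (λ s → expand-∑ ⟦ l′ ⟧ (λ (d , d′) t → powerSum s d * powerSum t d′) (factorisations e)))
         (expand-∑ ⟦ l ⟧ (λ (d , d′) s → expand ⟦ l′ ⟧ (λ t → powerSum s d * powerSum t d′)) (factorisations e)) ⟨
  expand ⟦ l ⟧ (λ s → expand ⟦ l′ ⟧ (λ t → ∑[ (d , d′) ∈ factorisations e ] powerSum s d * powerSum t d′))
    ≡⟨ expand-ext ⟦ l ⟧ (λ s → expand-ext ⟦ l′ ⟧ (λ t → powerSum-* s t e)) ⟩
  expand ⟦ l ⟧ (λ s → expand ⟦ l′ ⟧ (λ t → powerSum (s ++ t) e))
    ≡⟨ expand-++ l l′ _ ⟨
  expand ⟦ l ++ l′ ⟧ (λ s → powerSum s e)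
    ≡⟨ ρ-x ⟦ l ++ l′ ⟧ e ⟨
  coeff (ρ (x ⟦ l ++ l′ ⟧)) e ∎

-- Products concatenate parts whereas `_∣ᵖ_` merges them; this absorbs the resulting change of the
-- set partition `⟦_⟧`.
ρ-x-↭ : ∀ {l l′} → l ↭ l′ → ∀ e → coeff (ρ (x ⟦ l ⟧)) e ≡ coeff (ρ (x ⟦ l′ ⟧)) e
ρ-x-↭ {l} {l′} p e = trans (ρ-x ⟦ l ⟧ e) (trans (expand-↭ p (λ q → powerSum-↭ q e)) (sym (ρ-x ⟦ l′ ⟧ e)))

-- The coarsest term of the expansion

expand-⟦⟧-cong : ∀ {l} → All (0 <_) l → ∀ {h h′} →
  (∀ s → All (0 <_) s → sum s ≡ sum l → length l ≤ length s → h s ≡ h′ s) →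
  expand ⟦ l ⟧ h ≡ expand ⟦ l ⟧ h′
expand-⟦⟧-cong [] {h} {h′} eq = trans (expand-[] h) (trans (eq [] [] refl ℕ.z≤n) (sym (expand-[] h′)))
expand-⟦⟧-cong {a ∷ l} (0<a ∷ 0<l) {h} {h′} eq = begin
  expand ⟦ a ∷ l ⟧ h                                     ≡⟨ expand-∣ ⟦ a ⟧₁ ⟦ l ⟧ h ⟩
  expand ⟦ a ⟧₁ (λ s → expand ⟦ l ⟧ (λ t → h (s ++ t)))
    -- The factor `⟦ a ⟧₁` contributes at least one size, because its sizes add up to a positive
    -- `a`.
    ≡⟨ expand-cong ⟦ a ⟧₁ (λ s 0<s ∑s → expand-⟦⟧-cong 0<l (λ t 0<t ∑t l≤t → eq (s ++ t)
         (All.++⁺ 0<s 0<t)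
         (trans (sum-++ s t) (cong₂ ℕ._+_ ∑s ∑t))
         (subst (suc (length l) ≤_) (sym (List.length-++ s))
           (ℕ.+-mono-≤ (length-positive s (subst (0 <_) (sym ∑s) 0<a)) l≤t)))) ⟩
  expand ⟦ a ⟧₁ (λ s → expand ⟦ l ⟧ (λ t → h′ (s ++ t))) ≡⟨ expand-∣ ⟦ a ⟧₁ ⟦ l ⟧ h′ ⟨
  expand ⟦ a ∷ l ⟧ h′ ∎
  where
  length-positive : ∀ s → 0 < sum s → 0 < length s
  length-positive (_ ∷ _) _ = ℕ.z<s

subsets-⊤ : ∀ n → ∃[ rest ] subsets n ≡ ⊤ ∷ rest × All (_≢ ⊤) rest
subsets-⊤ zero = [] , refl , []
subsets-⊤ (suc n) with rest , eq , ≢⊤ ← subsets-⊤ n rewrite eq =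
  map (inside ∷_) rest ++ map (outside ∷_) (⊤ ∷ rest) , refl ,
  All.++⁺ (All.map⁺ (All.map (λ { ≢ refl → ≢ refl }) ≢⊤)) (All.map⁺ (All.universal (λ _ ()) (⊤ ∷ rest)))

opaque
  unfolding expand

  -- The only set partition of a nonempty set with fewer than two blocks is the one-block partition,
  -- whose Möbius value is `1`.
  expand-top : ∀ {a} → 0 < a → ∀ h → (∀ s → 2 ≤ length s → h s ≡ 0ℚ) → expand ⟦ a ⟧₁ h ≡ h (a ∷ [])
  expand-top {suc a} 0<a h h≡0 with rest , eq , ≢⊤ ← subsets-⊤ (suc a) = begin
    ∑⊆ (subsets (suc a)) G
      ≡⟨ cong (λ as → ∑⊆ as G) eq ⟩
    ∑⊆ (⊤ ∷ rest) G
      ≡⟨ ∑⊆-∷ ⊤ rest G ⟩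
    ∑⊆ rest (G ∘ (⊤ ∷_)) + ∑⊆ rest G
      -- Both sums shrink to their empty sublist. Next to `⊤` any further subset gives two sizes,
      -- where `h` vanishes; without `⊤` a single subset fails to cover, and more subsets again give
      -- two sizes.
      ≡⟨ cong₂ _+_
           (∑⊆-prune {Bad = _≢ ⊤} (prune-all ≢⊤) λ { {B ∷ bs} _ → long (⊤ ∷ B ∷ bs) (ℕ.s≤s (ℕ.s≤s ℕ.z≤n)) })
           (∑⊆-prune (prune-all ≢⊤) only⊤) ⟩
    (G (⊤ ∷ []) + 0ℚ) + (G [] + 0ℚ)
      ≡⟨ cong₂ _+_ (ℚ.+-identityʳ (G (⊤ ∷ []))) (trans (ℚ.+-identityʳ (G []))
           (χ-guard-0 (below? π []) {möbius π [] * h []}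
             λ (is , _) → contradiction (IsSetPartition.covering is Fin.zero) λ ())) ⟩
    G (⊤ ∷ []) + 0ℚ
      ≡⟨ ℚ.+-identityʳ (G (⊤ ∷ [])) ⟩
    G (⊤ ∷ [])
      ≡⟨ cong₂ _*_ (χ-yes (below? π (⊤ ∷ [])) (isSetPartition π , here (λ i∈ → i∈) ∷ []))
           (cong₂ _*_ möbius-self (cong (λ b → h (b ∷ [])) (∣⊤∣≡n (suc a)))) ⟩
    1ℚ * (1ℚ * h (suc a ∷ []))
      ≡⟨ trans (ℚ.*-identityˡ (1ℚ * h (suc a ∷ []))) (ℚ.*-identityˡ (h (suc a ∷ []))) ⟩
    h (suc a ∷ []) ∎
    where
    π : SetPartition (suc a)
    π = ⟦ suc a ⟧₁
    G : List (Subset (suc a)) → ℚ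
    G bs = χ (below? π bs) * (möbius π bs * h (sizes bs))
    long : ∀ bs → 2 ≤ length bs → G bs ≡ 0ℚ
    long bs 2≤ = χ-guard-0 (below? π bs) λ _ → trans
      (cong (möbius π bs *_) (h≡0 (sizes bs) (subst (2 ≤_) (sym (List.length-map ∣_∣ bs)) 2≤)))
      (ℚ.*-zeroʳ (möbius π bs))
    only⊤ : ∀ {bs} → Any (_≢ ⊤) bs → G bs ≡ 0ℚ
    only⊤ {B ∷ []} (here B≢⊤) = χ-guard-0 (below? π (B ∷ [])) λ (is , _) →
      contradiction (⊆-antisym ⊆⊤ (λ {i} _ → Any.head (λ ()) (IsSetPartition.covering is i))) B≢⊤
    only⊤ {B ∷ C ∷ bs} _ = long (B ∷ C ∷ bs) (ℕ.s≤s (ℕ.s≤s ℕ.z≤n))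
    möbius-self : möbius π (⊤ ∷ []) ≡ 1ℚ
    möbius-self = cong (λ z → prodℤ (möbiusSign (length z) ∷ []) / 1)
      (List.filter-accept (_⊆? ⊤) {x = ⊤ {suc a}} {xs = []} (λ i∈ → i∈))
      where
      möbiusSign : ℕ → ℤ
      möbiusSign k = (-1ℤ ℤ.^ (k ∸ 1)) ℤ.* ℤ.+ ((k ∸ 1) !)

-- Each single-block factor contributes one coarsest term and otherwise at least two parts.
expand-⟦⟧-top : ∀ {l} → All (0 <_) l → ∀ {h} → (∀ s → length l < length s → h s ≡ 0ℚ) → expand ⟦ l ⟧ h ≡ h l
expand-⟦⟧-top [] {h} h≡0 = expand-[] h
expand-⟦⟧-top {a ∷ l} (0<a ∷ 0<l) {h} h≡0 = begin
  expand ⟦ a ∷ l ⟧ h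
    ≡⟨ expand-∣ ⟦ a ⟧₁ ⟦ l ⟧ h ⟩
  expand ⟦ a ⟧₁ (λ s → expand ⟦ l ⟧ (λ t → h (s ++ t)))
    ≡⟨ expand-top 0<a _ (λ s 2≤s → trans
         (expand-⟦⟧-cong 0<l (λ t _ _ l≤t → h≡0 (s ++ t)
           (subst (suc (length l) <_) (sym (List.length-++ s)) (ℕ.+-mono-≤ 2≤s l≤t))))
         (expand-0 ⟦ l ⟧)) ⟩
  expand ⟦ l ⟧ (λ t → h (a ∷ t))
    ≡⟨ expand-⟦⟧-top 0<l (λ s → h≡0 (a ∷ s) ∘ ℕ.s≤s) ⟩
  h (a ∷ l) ∎

-- Triangular systems

-- Off the diagonal an entry may be nonzero only where `rank` strictly increases. A rank instead of
-- a total order spares any tie-breaking between indices of equal rank.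
module Triangular {I : Set} (_≟_ : DecidableEquality I) (T : I → I → ℚ) (rank : I → ℕ)
  (diagonal : ∀ i → T i i ≢ 0ℚ)
  (triangular : ∀ {i j} → i ≢ j → ¬ rank i < rank j → T i j ≡ 0ℚ) where

  T⁻¹ : I → ℚ
  T⁻¹ i = (1/ T i i) {{ℚ.≢-nonZero (diagonal i)}}

  *-T-T⁻¹ : ∀ q i → (q * T i i) * T⁻¹ i ≡ q
  *-T-T⁻¹ q i = trans (ℚ.*-assoc q (T i i) (T⁻¹ i))
    (trans (cong (q *_) (ℚ.*-inverseʳ (T i i) {{ℚ.≢-nonZero (diagonal i)}})) (ℚ.*-identityʳ q))

  *-T⁻¹-T : ∀ q i → (q * T⁻¹ i) * T i i ≡ q
  *-T⁻¹-T q i = trans (ℚ.*-assoc q (T⁻¹ i) (T i i))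
    (trans (cong (q *_) (ℚ.*-inverseˡ (T i i) {{ℚ.≢-nonZero (diagonal i)}})) (ℚ.*-identityʳ q))

  -- By induction on rank: in the equation for `j` all coefficients of smaller rank are already
  -- zero, which leaves `c j * T j j`. The bound `t` carries the induction.
  injective : ∀ (c : I → ℚ) {is} → Unique is → (∀ j → ∑[ i ∈ is ] c i * T i j ≡ 0ℚ) →
    ∀ {j} → j ∈ is → c j ≡ 0ℚ
  injective c {is} is! cT≡0 {j} j∈ = below (suc (rank j)) j∈ ℕ.≤-refl
    where
    below : ∀ t {j} → j ∈ is → rank j < t → c j ≡ 0ℚ
    below (suc t) {j} j∈ (ℕ.s≤s j≤t) = begin
      c j                     ≡⟨ *-T-T⁻¹ (c j) j ⟨
      (c j * T j j) * T⁻¹ j   ≡⟨ cong (_* T⁻¹ j) (trans (sym (∑-single is! j∈ off)) (cT≡0 j)) ⟩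
      0ℚ * T⁻¹ j              ≡⟨ ℚ.*-zeroˡ (T⁻¹ j) ⟩
      0ℚ                      ∎
      where
      off : ∀ {i} → i ∈ is → i ≢ j → c i * T i j ≡ 0ℚ
      off {i} i∈ i≢j with rank i ℕ.<? rank j
      ... | yes i<j = trans (cong (_* T i j) (below t i∈ (ℕ.<-≤-trans i<j j≤t))) (ℚ.*-zeroˡ (T i j))
      ... | no  i≮j = trans (cong (c i *_) (triangular i≢j i≮j)) (ℚ.*-zeroʳ (c i))

  offDiagonal : I → I → ℚ
  offDiagonal i j = χ (¬? (i ≟ j)) * T i j

  offDiagonal-0 : ∀ {i j} → ¬ rank i < rank j → offDiagonal i j ≡ 0ℚ
  offDiagonal-0 {i} {j} i≮j = χ-guard-0 (¬? (i ≟ j)) (λ i≢j → triangular i≢j i≮j)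

  split : ∀ i j → T i j ≡ χ (i ≟ j) * T i j + offDiagonal i j
  split i j with i ≟ j
  ... | yes _ = sym (trans (cong₂ _+_ (ℚ.*-identityˡ (T i j)) (ℚ.*-zeroˡ (T i j))) (ℚ.+-identityʳ (T i j)))
  ... | no  _ = sym (trans (cong₂ _+_ (ℚ.*-zeroˡ (T i j)) (ℚ.*-identityˡ (T i j))) (ℚ.+-identityˡ (T i j)))

  ∑-split : ∀ {Λ} → Unique Λ → ∀ {j} → j ∈ Λ → ∀ (c : I → ℚ) →
    ∑[ i ∈ Λ ] c i * T i j ≡ c j * T j j + (∑[ i ∈ Λ ] c i * offDiagonal i j)
  ∑-split {Λ} Λ! {j} j∈ c = begin
    ∑[ i ∈ Λ ] c i * T i j
      ≡⟨ ∑-cong (λ i → trans (cong (c i *_) (split i j)) (ℚ.*-distribˡ-+ (c i) (χ (i ≟ j) * T i j) (offDiagonal i j))) Λ ⟩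
    ∑[ i ∈ Λ ] (c i * (χ (i ≟ j) * T i j) + c i * offDiagonal i j)
      ≡⟨ ∑-+ (λ i → c i * (χ (i ≟ j) * T i j)) (λ i → c i * offDiagonal i j) Λ ⟩
    (∑[ i ∈ Λ ] c i * (χ (i ≟ j) * T i j)) + (∑[ i ∈ Λ ] c i * offDiagonal i j)
      ≡⟨ cong (_+ (∑[ i ∈ Λ ] c i * offDiagonal i j)) (trans
           (∑-single Λ! j∈ (λ {i} _ i≢j → trans
             (cong (c i *_) (χ-guard-0 (i ≟ j) (λ i≡j → contradiction i≡j i≢j))) (ℚ.*-zeroʳ (c i))))
           (cong (c j *_) (trans (cong (_* T j j) (χ-yes (j ≟ j) refl)) (ℚ.*-identityˡ (T j j))))) ⟩
    c j * T j j + (∑[ i ∈ Λ ] c i * offDiagonal i j) ∎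

  -- Jacobi iteration: the entry at j is final after rank j + 1 steps.
  jacobi : List I → (I → ℚ) → ℕ → I → ℚ
  jacobi Λ f zero    j = 0ℚ
  jacobi Λ f (suc t) j = (f j - (∑[ i ∈ Λ ] jacobi Λ f t i * offDiagonal i j)) * T⁻¹ j

  -- The update at `j` reads only entries of smaller rank, and these have settled one step earlier.
  jacobi-stable : ∀ Λ f t {j} → rank j < t → jacobi Λ f (suc t) j ≡ jacobi Λ f t j
  jacobi-stable Λ f (suc t) {j} (ℕ.s≤s j≤t) =
    cong (λ s → (f j - s) * T⁻¹ j) (∑-cong stable Λ)
    where
    stable : ∀ i → jacobi Λ f (suc t) i * offDiagonal i j ≡ jacobi Λ f t i * offDiagonal i j
    stable i with rank i ℕ.<? rank j
    ... | yes i<j = cong (_* offDiagonal i j) (jacobi-stable Λ f t (ℕ.<-≤-trans i<j j≤t))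
    ... | no  i≮j = trans (cong (jacobi Λ f (suc t) i *_) (offDiagonal-0 i≮j)) (trans
      (ℚ.*-zeroʳ (jacobi Λ f (suc t) i))
      (sym (trans (cong (jacobi Λ f t i *_) (offDiagonal-0 i≮j)) (ℚ.*-zeroʳ (jacobi Λ f t i)))))

  solution : ∀ {Λ} → Unique Λ → (∀ i → i ∈ Λ) → ∀ {N} → (∀ i → rank i ≤ N) → ∀ f →
    ∃[ c ] (∀ j → ∑[ i ∈ Λ ] c i * T i j ≡ f j)
  solution {Λ} Λ! all∈Λ {N} rank≤N f = c , λ j → begin
    ∑[ i ∈ Λ ] c i * T i j
      ≡⟨ ∑-split Λ! (all∈Λ j) c ⟩
    c j * T j j + rest j
      -- No rank exceeds `N`, so `suc N` steps reach a fixed point; rewriting `c j` as one more step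
      -- exposes the factor `T⁻¹ j`.
      ≡⟨ cong (λ q → q * T j j + rest j) (jacobi-stable Λ f (suc N) (ℕ.s≤s (rank≤N j))) ⟨
    ((f j - rest j) * T⁻¹ j) * T j j + rest j
      ≡⟨ cong (_+ rest j) (*-T⁻¹-T (f j - rest j) j) ⟩
    (f j - rest j) + rest j
      ≡⟨ cancel (f j) (rest j) ⟩
    f j ∎
    where
    c : I → ℚ
    c = jacobi Λ f (suc N)
    rest : I → ℚ
    rest j = ∑[ i ∈ Λ ] c i * offDiagonal i j
    cancel : ∀ q r → (q - r) + r ≡ q
    cancel = solve 2 (λ q r → (q :- r) :+ r := q) refl where open +-*-Solver

-- Transition matrices

≡-partition : ∀ {μ ν : IntegerPartition n} → parts μ ≡ parts ν → μ ≡ ν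
≡-partition {μ = mkPartition _ s p q} {mkPartition _ s′ p′ q′} refl
  rewrite Linked.irrelevant ℕ.≤-irrelevant s s′ | All.irrelevant ℕ.<-irrelevant p p′ | ℕ.≡-irrelevant q q′ = refl

infix 4 _≟ᴾ_
_≟ᴾ_ : DecidableEquality (IntegerPartition n)
μ ≟ᴾ ν = map′ ≡-partition (cong parts) (parts μ ≟ᴸ parts ν)

↭-partition : ∀ {μ ν : IntegerPartition n} → parts μ ↭ parts ν → μ ≡ ν
↭-partition {μ = μ} {ν} p = ≡-partition (Pointwise-≡⇒≡
  (↗↭↗⇒≋ (DecTotalOrder.totalOrder (flipOrder ℕ.≤-decTotalOrder)) (nonincreasing μ) (nonincreasing ν) (↭⇒↭ₛ p)))

toPartition : ∀ s → All (0 <_) s → sum s ≡ n → IntegerPartition n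
toPartition s 0<s ∑s = mkPartition (sort s) (sort-↗ s)
  (Perm.All-resp-↭ (↭-sym (sort-↭ s)) 0<s) (trans (sum-↭ (sort-↭ s)) ∑s)

length≤sum : ∀ {s} → All (0 <_) s → length s ≤ sum s
length≤sum []          = ℕ.z≤n
length≤sum (0<a ∷ 0<s) = ℕ.+-mono-≤ 0<a (length≤sum 0<s)

length-parts≤ : ∀ (μ : IntegerPartition n) → length (parts μ) ≤ n
length-parts≤ μ = subst (length (parts μ) ≤_) (size μ) (length≤sum (positive μ))

all≤sum : ∀ s → All (_≤ sum s) s
all≤sum []      = []
all≤sum (a ∷ s) = ℕ.m≤m+n a (sum s) ∷ All.map (λ b≤ → ℕ.≤-trans b≤ (ℕ.m≤n+m (sum s) a)) (all≤sum s)

∈-words : ∀ {k w} → All (_< k) w → w ∈ words k (length w)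
∈-words []          = here refl
∈-words (a<k ∷ w<k) = ∈-cartesianProductWith⁺ _∷_ (∈-upTo⁺ a<k) (∈-words w<k)

partition? : ∀ n → List ℕ → List (IntegerPartition n)
partition? n w with Linked.linked? ℕ._≥?_ w | All.all? (0 ℕ.<?_) w | sum w ℕ.≟ n
... | yes s | yes p | yes q = mkPartition w s p q ∷ []
... | _     | _     | _     = []

∈-partition? : ∀ (μ : IntegerPartition n) → μ ∈ partition? n (parts μ)
∈-partition? {n} μ with Linked.linked? ℕ._≥?_ (parts μ) | All.all? (0 ℕ.<?_) (parts μ) | sum (parts μ) ℕ.≟ n
... | yes s | yes p | yes q = here (≡-partition refl)
... | no ¬s | _     | _     = contradiction (nonincreasing μ) ¬s
... | yes _ | no ¬p | _     = contradiction (positive μ) ¬p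
... | yes _ | yes _ | no ¬q = contradiction (size μ) ¬q

-- A partition of `n` has at most `n` parts, each at most `n`, so it occurs among the words searched
-- here. `deduplicate` yields uniqueness without an analysis of the search.
partitions : ∀ n → List (IntegerPartition n)
partitions n = deduplicate _≟ᴾ_ (concatMap (λ k → concatMap (partition? n) (words (suc n) k)) (upTo (suc n)))

partitions-! : ∀ n → Unique (partitions n)
partitions-! n = deduplicate-! _≟ᴾ_ _

∈-partitions : ∀ (μ : IntegerPartition n) → μ ∈ partitions n
∈-partitions {n} μ = ∈-deduplicate⁺ _≟ᴾ_ (∈-concatMap⁺ _ (Any.map
  (λ { refl → ∈-concatMap⁺ (partition? n) (Any.map (λ { refl → ∈-partition? μ }) (∈-words (All.map ℕ.s≤s parts≤n))) })
  (∈-upTo⁺ (ℕ.s≤s (length-parts≤ μ)))))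
  where
  parts≤n : All (_≤ n) (parts μ)
  parts≤n = subst (λ m → All (_≤ m) (parts μ)) (size μ) (all≤sum (parts μ))

-- Symmetric series and their coefficients at partitions

coeff-zeros : ∀ f e k → coeff f (e ++ zeros k) ≡ coeff f e
coeff-zeros f e zero    = cong (coeff f) (List.++-identityʳ e)
coeff-zeros f e (suc k) = begin
  coeff f (e ++ 0 ∷ zeros k)       ≡⟨ cong (coeff f) (List.++-assoc e (0 ∷ []) (zeros k)) ⟨
  coeff f ((e ∷ʳ 0) ++ zeros k)    ≡⟨ coeff-zeros f (e ∷ʳ 0) k ⟩
  coeff f (e ∷ʳ 0)                 ≡⟨ coeff-∷ʳ f e ⟩
  coeff f e                        ∎

↭-nonzeros : ∀ e → ∃[ k ] (e ↭ nonzeros e ++ zeros k)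
↭-nonzeros []          = 0 , ↭-refl
↭-nonzeros (zero ∷ e)  = let k , p = ↭-nonzeros e in
  suc k , ↭-trans (Perm.prep 0 p) (↭-sym (Perm.shift 0 (nonzeros e) (zeros k)))
↭-nonzeros (suc a ∷ e) = let k , p = ↭-nonzeros e in k , Perm.prep (suc a) p

sum-nonzeros : ∀ e → sum (nonzeros e) ≡ sum e
sum-nonzeros []          = refl
sum-nonzeros (zero ∷ e)  = sum-nonzeros e
sum-nonzeros (suc a ∷ e) = cong (suc a ℕ.+_) (sum-nonzeros e)

-- Every exponent list rearranges to a partition followed by zeros. Thus `coeff f (parts μ)` serves
-- as the coordinate of `f` at the monomial symmetric function of `μ`, without that basis being
-- constructed.
Sym-ext : ∀ {f g} → Sym n f → Sym n g →
  (∀ (μ : IntegerPartition n) → coeff f (parts μ) ≡ coeff g (parts μ)) → f ≈ˢ g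
Sym-ext {n} {f} {g} Sf Sg eq e with sum e ℕ.≟ n
... | no  ≢n = trans (Sym.homogeneous Sf e ≢n) (sym (Sym.homogeneous Sg e ≢n))
... | yes ≡n = trans (reduce Sf) (trans (eq μ) (sym (reduce Sg)))
  where
  μ : IntegerPartition n
  μ = toPartition (nonzeros e) (All.all-filter (0 ℕ.<?_) e) (trans (sum-nonzeros e) ≡n)
  reduce : ∀ {h} → Sym n h → coeff h e ≡ coeff h (parts μ)
  reduce {h} Sh = let k , p = ↭-nonzeros e in
    trans (Sym.symmetric Sh (↭-trans p (Perm.++⁺ʳ (zeros k) (↭-sym (sort-↭ (nonzeros e)))))) (coeff-zeros h (parts μ) k)

coeff-linearCombination : ∀ {I : Set} (c : I → ℚ) (v : I → Series) is e →
  coeff (linearCombination c v is) e ≡ ∑[ i ∈ is ] c i * coeff (v i) e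
coeff-linearCombination c v []       e = refl
coeff-linearCombination c v (i ∷ is) e = cong (c i * coeff (v i) e +_) (coeff-linearCombination c v is e)

Sym-linearCombination : ∀ {I : Set} {v : I → Series} → (∀ i → Sym n (v i)) → ∀ c is → Sym n (linearCombination c v is)
Sym-linearCombination {v = v} Sv c is = record
  { homogeneous = λ e ≢n → trans (coeff-linearCombination c v is e) (∑-zeroᴬ (All.universal
      (λ i → trans (cong (c i *_) (Sym.homogeneous (Sv i) e ≢n)) (ℚ.*-zeroʳ (c i))) is))
  ; symmetric = λ {e} {e′} p → trans (coeff-linearCombination c v is e) (trans
      (∑-cong (λ i → cong (c i *_) (Sym.symmetric (Sv i) p)) is)
      (sym (coeff-linearCombination c v is e′)))
  }

Sym-xᵖ : ∀ (μ : IntegerPartition n) → Sym n (xᵖ μ)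
Sym-xᵖ μ = record
  { homogeneous = λ e ≢n → trans (ρ-x ⟦ parts μ ⟧ e) (trans
      (expand-cong ⟦ parts μ ⟧ (λ s _ ∑s → powerSum-homogeneous s e (λ eq → ≢n (trans eq (trans ∑s (size μ))))))
      (expand-0 ⟦ parts μ ⟧))
  ; symmetric = λ {e} {e′} p → trans (ρ-x ⟦ parts μ ⟧ e) (trans
      (expand-ext ⟦ parts μ ⟧ (λ s → powerSum-symmetric s p))
      (sym (ρ-x ⟦ parts μ ⟧ e′)))
  }

-- xᵖ λ = Σ_μ xToPower λ μ · p_μ, and p_μ = Σ_ν powerToMonomial μ ν · m_ν.

xToPower : IntegerPartition n → IntegerPartition n → ℚ
xToPower μ ν = expand ⟦ parts μ ⟧ (λ s → χ (sort s ≟ᴸ parts ν))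

powerToMonomial : IntegerPartition n → IntegerPartition n → ℚ
powerToMonomial μ ν = powerSum (parts μ) (parts ν)

-- Terms are grouped by the sorted list of block sizes: each list of sizes selects exactly one
-- partition, and `powerSum` does not depend on the order.
xᵖ-expansion : ∀ (μ : IntegerPartition n) e →
  coeff (xᵖ μ) e ≡ ∑[ ν ∈ partitions n ] xToPower μ ν * powerSum (parts ν) e
xᵖ-expansion {n} μ e = begin
  coeff (xᵖ μ) e
    ≡⟨ ρ-x ⟦ parts μ ⟧ e ⟩
  expand ⟦ parts μ ⟧ (λ s → powerSum s e)
    ≡⟨ expand-cong ⟦ parts μ ⟧ (λ s 0<s ∑s → sym (select s 0<s (trans ∑s (size μ)))) ⟩
  expand ⟦ parts μ ⟧ (λ s → ∑[ ν ∈ partitions n ] χ (sort s ≟ᴸ parts ν) * powerSum (parts ν) e)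
    ≡⟨ expand-∑ ⟦ parts μ ⟧ (λ ν s → χ (sort s ≟ᴸ parts ν) * powerSum (parts ν) e) (partitions n) ⟩
  ∑[ ν ∈ partitions n ] expand ⟦ parts μ ⟧ (λ s → χ (sort s ≟ᴸ parts ν) * powerSum (parts ν) e)
    ≡⟨ ∑-cong (λ ν → expand-*ʳ ⟦ parts μ ⟧ (powerSum (parts ν) e) (λ s → χ (sort s ≟ᴸ parts ν))) (partitions n) ⟩
  ∑[ ν ∈ partitions n ] xToPower μ ν * powerSum (parts ν) e ∎
  where
  select : ∀ s → All (0 <_) s → sum s ≡ n →
    ∑[ ν ∈ partitions n ] χ (sort s ≟ᴸ parts ν) * powerSum (parts ν) e ≡ powerSum s e
  select s 0<s ∑s = begin
    ∑[ ν ∈ partitions n ] χ (sort s ≟ᴸ parts ν) * powerSum (parts ν) e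
      ≡⟨ ∑-single (partitions-! n) (∈-partitions σ) (λ {ν} _ ν≢σ →
           χ-guard-0 (sort s ≟ᴸ parts ν) (λ eq → contradiction (≡-partition (sym eq)) ν≢σ)) ⟩
    χ (sort s ≟ᴸ sort s) * powerSum (sort s) e
      ≡⟨ trans (cong (_* powerSum (sort s) e) (χ-yes (sort s ≟ᴸ sort s) refl)) (ℚ.*-identityˡ _) ⟩
    powerSum (sort s) e
      ≡⟨ powerSum-↭ (sort-↭ s) e ⟩
    powerSum s e ∎
    where
    σ : IntegerPartition n
    σ = toPartition s 0<s ∑s

-- A set partition strictly below `⟦ parts μ ⟧` has more blocks than `μ` has parts, so for `ν` no
-- longer than `μ` only the coarsest one can contribute.
xToPower-top : ∀ {μ ν : IntegerPartition n} → ¬ length (parts μ) < length (parts ν) →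
  xToPower μ ν ≡ χ (sort (parts μ) ≟ᴸ parts ν)
xToPower-top {μ = μ} {ν} μ≮ν = expand-⟦⟧-top (positive μ) λ s μ<s → χ-no (sort s ≟ᴸ parts ν)
  λ eq → μ≮ν (subst (length (parts μ) <_) (trans (sym (Perm.↭-length (sort-↭ s))) (cong length eq)) μ<s)

sort-parts : ∀ {μ ν : IntegerPartition n} → sort (parts μ) ≡ parts ν → μ ≡ ν
sort-parts {μ = μ} eq = ↭-partition (↭-trans (↭-sym (sort-↭ (parts μ))) (↭-reflexive eq))

sort-self : ∀ (μ : IntegerPartition n) → sort (parts μ) ≡ parts μ
sort-self μ = cong parts (↭-partition {μ = toPartition (parts μ) (positive μ) (size μ)} {μ} (sort-↭ (parts μ)))

-- Strict refinement increases the number of blocks, so the number of parts is the rank. The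
-- diagonal entry is `1`, from `⟦ parts μ ⟧` itself.
module XToPower {n} = Triangular (_≟ᴾ_ {n}) xToPower (length ∘ parts)
  (λ μ eq → contradiction (trans (sym (χ-yes (sort (parts μ) ≟ᴸ parts μ) (sort-self μ)))
    (trans (sym (xToPower-top {μ = μ} {μ} (ℕ.<-irrefl refl))) eq)) λ ())
  (λ {μ} {ν} μ≢ν μ≮ν → trans (xToPower-top {μ = μ} {ν} μ≮ν) (χ-no (sort (parts μ) ≟ᴸ parts ν) (μ≢ν ∘ sort-parts)))

-- Merging lowers the number of parts, so here the rank is its complement in `n`; the truncated
-- subtraction is strictly monotone because no partition of `n` has more than `n` parts.
module PowerToMonomial {n} = Triangular (_≟ᴾ_ {n}) powerToMonomial (λ μ → n ∸ length (parts μ))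
  (λ μ → powerSum-diagonal (parts μ))
  (λ {μ} {ν} μ≢ν μ≮ν → powerSum-triangular (positive μ) (positive ν) (μ≢ν ∘ ↭-partition)
    (λ ν<μ → μ≮ν (ℕ.∸-monoʳ-< ν<μ (length-parts≤ μ))))

∑-xᵖ : ∀ (c : IntegerPartition n → ℚ) is e → ∑[ μ ∈ is ] c μ * coeff (xᵖ μ) e ≡
  ∑[ ν ∈ partitions n ] (∑[ μ ∈ is ] c μ * xToPower μ ν) * powerSum (parts ν) e
∑-xᵖ {n} c is e = begin
  ∑[ μ ∈ is ] c μ * coeff (xᵖ μ) e
    ≡⟨ ∑-cong (λ μ → trans (cong (c μ *_) (xᵖ-expansion μ e)) (trans
         (sym (∑-*ˡ (c μ) (λ ν → xToPower μ ν * powerSum (parts ν) e) (partitions n)))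
         (∑-cong (λ ν → sym (ℚ.*-assoc (c μ) (xToPower μ ν) (powerSum (parts ν) e))) (partitions n)))) is ⟩
  ∑[ μ ∈ is ] ∑[ ν ∈ partitions n ] (c μ * xToPower μ ν) * powerSum (parts ν) e
    ≡⟨ ∑-swap _ is (partitions n) ⟩
  ∑[ ν ∈ partitions n ] ∑[ μ ∈ is ] (c μ * xToPower μ ν) * powerSum (parts ν) e
    ≡⟨ ∑-cong (λ ν → ∑-*ʳ (powerSum (parts ν) e) (λ μ → c μ * xToPower μ ν) is) (partitions n) ⟩
  ∑[ ν ∈ partitions n ] (∑[ μ ∈ is ] c μ * xToPower μ ν) * powerSum (parts ν) e ∎

xᵖ-basis : ∀ n → IsBasis (Sym n) (λ (μ : IntegerPartition n) → xᵖ μ)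
xᵖ-basis n = record
  { inSubspace  = Sym-xᵖ
  ; independent = λ c is is! lc≈0 → XToPower.injective c is! λ ν →
      -- The coefficients at the partitions `κ` alone form a triangular system for the power sum
      -- coordinates of the combination, so these coordinates vanish.
      PowerToMonomial.injective (λ ν → ∑[ μ ∈ is ] c μ * xToPower μ ν) (partitions-! n)
        (λ κ → trans (sym (∑-xᵖ c is (parts κ))) (trans (sym (coeff-linearCombination c xᵖ is (parts κ))) (lc≈0 (parts κ))))
        (∈-partitions ν)
  ; spanning    = λ f Sf →
      -- `d` holds the power sum coordinates of `f`, found from its monomial coefficients; `c` then
      -- solves for the coordinates in the `xᵖ`.
      let d , d-solves = PowerToMonomial.solution (partitions-! n) ∈-partitions
            (λ μ → ℕ.m∸n≤m n (length (parts μ))) (coeff f ∘ parts)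
          c , c-solves = XToPower.solution (partitions-! n) ∈-partitions length-parts≤ d
      in c , partitions n , Sym-ext Sf (Sym-linearCombination Sym-xᵖ c (partitions n)) λ κ → sym (begin
           coeff (linearCombination c xᵖ (partitions n)) (parts κ)
             ≡⟨ coeff-linearCombination c xᵖ (partitions n) (parts κ) ⟩
           ∑[ μ ∈ partitions n ] c μ * coeff (xᵖ μ) (parts κ)
             ≡⟨ ∑-xᵖ c (partitions n) (parts κ) ⟩
           ∑[ ν ∈ partitions n ] (∑[ μ ∈ partitions n ] c μ * xToPower μ ν) * powerToMonomial ν κ
             ≡⟨ ∑-cong (λ ν → cong (_* powerToMonomial ν κ) (c-solves ν)) (partitions n) ⟩
           ∑[ ν ∈ partitions n ] d ν * powerToMonomial ν κ
             ≡⟨ d-solves κ ⟩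
           coeff f (parts κ) ∎)
  }

proposition3p5 : (∀ (n : ℕ) → n ≥ 1 → IsBasis (Sym n) (λ (μ : IntegerPartition n) → xᵖ μ))
    × (∀ {n m : ℕ} (μ : IntegerPartition n) (γ : IntegerPartition m) → xᵖ μ *ˢ xᵖ γ ≈ˢ xᵖ (μ ∣ᵖ γ))
proposition3p5 = (λ n _ → xᵖ-basis n) , λ μ γ e → trans
  (ρ-x-* (parts μ) (parts γ) e)
  (ρ-x-↭ (↭-sym (Perm.merge-↭ ℕ._≥?_ (parts μ) (parts γ))) e)
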